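{- Let $G$ be a connected graph with at least two vertices and girth at least $7$ (trees included). Then $\dim_{n\ell}(G)\le \beta'(G)-1$. Moreover, if $G$ is a tree, then $\dim_{n\ell}(G)=\beta'(G)-1$ if and only if $G$ is obtained from a star $K_{1,m}$ ($m\ge 1$) by keeping one of its edges unchanged and subdividing each of the remaining edges at most once (i.e., replacing each remaining edge either by itself or by a path of length $2$).
   Context: Graphs are finite, simple and connected; $d_G(u,v)$ is the shortest-path distance. The girth is the length of a shortest cycle (infinite for acyclic graphs). The edge cover number $\beta'(G)$ is the minimum number of edges such that every vertex is incident with at least one of them. A set $X\subseteq V(G)$ resolves two vertices $u,v$ if some $x\in X$ satisfies $d_G(u,x)\neq d_G(v,x)$. $X$ is a nonlocal resolving set if it resolves every pair of distinct non-adjacent vertices; the nonlocal metric dimension $\dim_{n\ell}(G)$ is the minimum size of a nonlocal resolving set (so $\dim_{n\ell}(K_n)=0$). -}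

module Defs where

open import Data.Empty using (⊥)
open import Data.Fin using (Fin; zero; suc; toℕ; fromℕ<; _<_; _<?_)
open import Data.Fin.Properties using (_≟_; any?; all?; <-cmp; injective⇒≤; toℕ-fromℕ<)
open import Data.Fin.Subset using (Subset; _∈_; _∉_; ∣_∣; ⊤)
open import Data.Fin.Subset.Properties using (_∈?_; anySubset?; ∈⊤)
open import Data.List using (List; filter; cartesianProduct; allFin; length; lookup)
open import Data.List.Membership.Propositional using () renaming (_∈_ to _∈ˡ_)
open import Data.List.Membership.Propositional.Properties using (∈-filter⁺; ∈-allFin; ∈-cartesianProduct⁺)
open import Data.List.Relation.Unary.Any using (index)
open import Data.List.Relation.Unary.Any.Properties using (lookup-index)
open import Data.Nat using (ℕ; zero; suc; _≤_; z≤n; s≤s)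
open import Data.Nat.Properties using () renaming (_≟_ to _≟ᴺ_)
open import Data.Product using (∃; _×_; _,_; proj₁; proj₂)
open import Data.Sum using (_⊎_; inj₁; inj₂)
open import Data.Vec using (Vec; []; _∷_; head; last) renaming (lookup to lookupᵛ)
open import Data.Vec.Relation.Unary.All using ([])
open import Data.Vec.Relation.Unary.AllPairs using (allPairs?; []; _∷_)
open import Data.Vec.Relation.Unary.Linked using (Linked; linked?; [-]; _∷_)
open import Data.Vec.Relation.Unary.Unique.Propositional using (Unique)
open import Data.Vec.Relation.Unary.Unique.Propositional.Properties using (lookup-injective)
open import Function.Bundles using (_↔_; _⇔_; Inverse)
open import Level using (0ℓ)
open import Relation.Binary using (Rel; Symmetric; Irreflexive; tri<; tri≈; tri>) renaming (Decidable to Decidable₂)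
open import Relation.Binary.Construct.Closure.Symmetric using (SymClosure; fwd; bwd; symmetric)
open import Relation.Binary.PropositionalEquality using (_≡_; _≢_; refl; sym; trans; cong; subst)
open import Relation.Nullary using (¬_; Dec; yes; no; ¬?; _×-dec_; _⊎-dec_; _→-dec_; contradiction)
open import Relation.Nullary.Construct.Add.Supremum using (_⁺; ⊤⁺; [_])
open import Relation.Nullary.Decidable using (map′)
open import Relation.Unary using (Pred; Decidable)

IsLeast : Pred ℕ 0ℓ → Pred ℕ 0ℓ
IsLeast P m = P m × (∀ k → P k → m ≤ k)

least′ : {P : Pred ℕ 0ℓ} → Decidable P → ∀ k → P k → ∃ (IsLeast P)
least′ P? zero p = 0 , p , λ _ _ → z≤n
least′ {P} P? (suc k) p with P? 0
... | yes p₀ = 0 , p₀ , λ _ _ → z≤n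
... | no ¬p₀ with least′ {λ j → P (suc j)} (λ j → P? (suc j)) k p
...   | m , pm , min = suc m , pm , λ where
        zero    q → contradiction q ¬p₀
        (suc j) q → s≤s (min j q)

least : {P : Pred ℕ 0ℓ} → Decidable P → ∃ P → ∃ (IsLeast P)
least P? (k , p) = least′ P? k p

HasSize : ∀ {n} → Pred (Subset n) 0ℓ → Pred ℕ 0ℓ
HasSize P k = ∃ λ S → P S × ∣ S ∣ ≡ k

minSize : ∀ {n} {P : Pred (Subset n) 0ℓ} → Decidable P → ∃ P → ∃ (IsLeast (HasSize P))
minSize P? (S , p) =
  least (λ k → anySubset? (λ T → P? T ×-dec (∣ T ∣ ≟ᴺ k))) (∣ S ∣ , S , p , refl)

anyVec? : ∀ {n k} {P : Pred (Vec (Fin n) k) 0ℓ} → Decidable P → Dec (∃ P)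
anyVec? {k = zero} P? = map′ (λ p → [] , p) (λ where ([] , p) → p) (P? [])
anyVec? {k = suc k} P? =
  map′ (λ (x , xs , p) → x ∷ xs , p) (λ where (x ∷ xs , p) → x , xs , p)
       (any? λ x → anyVec? λ xs → P? (x ∷ xs))

-- Simple graphs; the finite ones are those on Fin n.
-- Adjacency is decidable, as it is for any finite graph classically.
record Graph (V : Set) : Set₁ where
  field
    Adj    : Rel V 0ℓ
    adj?   : Decidable₂ Adj
    symm   : Symmetric Adj
    irrefl : Irreflexive _≡_ Adj

open Graph public

record _≅_ {V W : Set} (G : Graph V) (H : Graph W) : Set where
  field
    bijection : V ↔ W
    adjacency : ∀ u v → Adj G u v ⇔ Adj H (Inverse.to bijection u) (Inverse.to bijection v)

IsPath : ∀ {V k} → Graph V → Pred (Vec V k) 0ℓ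
IsPath G xs = Linked (Adj G) xs × Unique xs

-- The length of a path is its number of edges, so a path of length k
-- has suc k vertices.
PathOfLength : ∀ {V} → Graph V → V → V → Pred ℕ 0ℓ
PathOfLength {V} G u v k =
  ∃ λ (xs : Vec V (suc k)) → IsPath G xs × head xs ≡ u × last xs ≡ v

Connected : ∀ {V} → Graph V → Set
Connected G = ∀ u v → ∃ (PathOfLength G u v)

CycleOfLength : ∀ {V} → Graph V → Pred ℕ 0ℓ
CycleOfLength {V} G (suc (suc (suc k))) =
  ∃ λ (xs : Vec V (suc (suc (suc k)))) → IsPath G xs × Adj G (last xs) (head xs)
CycleOfLength G _ = ⊥

Acyclic : ∀ {V} → Graph V → Set
Acyclic G = ¬ ∃ (CycleOfLength G)

IsTree : ∀ {V} → Graph V → Set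
IsTree G = Connected G × Acyclic G

module _ {n : ℕ} (G : Graph (Fin n)) where

  isPath? : ∀ {k} → Decidable (IsPath {k = k} G)
  isPath? xs = linked? (adj? G) xs ×-dec allPairs? (λ x y → ¬? (x ≟ y)) xs

  pathOfLength? : ∀ u v → Decidable (PathOfLength G u v)
  pathOfLength? u v k =
    anyVec? λ xs → isPath? xs ×-dec (head xs ≟ u) ×-dec (last xs ≟ v)

  cycleOfLength? : Decidable (CycleOfLength G)
  cycleOfLength? 0 = no λ ()
  cycleOfLength? 1 = no λ ()
  cycleOfLength? 2 = no λ ()
  cycleOfLength? (suc (suc (suc k))) =
    anyVec? λ xs → isPath? xs ×-dec adj? G (last xs) (head xs)

  cycleLength≤n : ∀ k → CycleOfLength G k → k ≤ n
  cycleLength≤n (suc (suc (suc k))) (xs , (_ , uniq) , _) =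
    injective⇒≤ {f = lookupᵛ xs} (λ {i} {j} → lookup-injective uniq i j)

  hasCycle? : Dec (∃ (CycleOfLength G))
  hasCycle? = map′
    (λ (i , c) → toℕ i , c)
    (λ (k , c) → let k<1+n = s≤s (cycleLength≤n k c) in
       fromℕ< k<1+n , subst (CycleOfLength G) (sym (toℕ-fromℕ< k<1+n)) c)
    (any? {suc n} λ i → cycleOfLength? (toℕ i))

  -- ⊤⁺ is the infinite girth of an acyclic graph.
  girth : ℕ ⁺
  girth with hasCycle?
  ... | yes c = [ proj₁ (least cycleOfLength? c) ]
  ... | no  _ = ⊤⁺

module _ {n : ℕ} (G : Graph (Fin n)) (conn : Connected G) where

  dist : Fin n → Fin n → ℕ
  dist u v = proj₁ (least (pathOfLength? G u v) (conn u v))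

  Resolves : Subset n → Fin n → Fin n → Set
  Resolves X u v = ∃ λ x → x ∈ X × dist u x ≢ dist v x

  NonlocalResolving : Pred (Subset n) 0ℓ
  NonlocalResolving X = ∀ u v → u ≢ v → ¬ Adj G u v → Resolves X u v

  nonlocalResolving? : Decidable NonlocalResolving
  nonlocalResolving? X =
    all? λ u → all? λ v → ¬? (u ≟ v) →-dec (¬? (adj? G u v) →-dec
      any? λ x → (x ∈? X) ×-dec ¬? (dist u x ≟ᴺ dist v x))

  dist-self : ∀ u → dist u u ≡ 0
  dist-self u with dist u u | proj₂ (proj₂ (least (pathOfLength? G u u) (conn u u)))
  ... | zero  | _   = refl
  ... | suc _ | min with () ← min 0 (u ∷ [] , ([-] , [] ∷ []) , refl , refl)

  dist≡0⇒≡ : ∀ u v → dist u v ≡ 0 → u ≡ v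
  dist≡0⇒≡ u v eq
    with x ∷ [] , _ , refl , refl ← subst (PathOfLength G u v) eq
           (proj₁ (proj₂ (least (pathOfLength? G u v) (conn u v)))) = refl

  nonlocalResolving-⊤ : NonlocalResolving ⊤
  nonlocalResolving-⊤ u v u≢v _ =
    u , ∈⊤ , λ eq → u≢v (sym (dist≡0⇒≡ v u (trans (sym eq) (dist-self u))))

  nonlocalDim : ℕ
  nonlocalDim = proj₁ (minSize nonlocalResolving? (⊤ , nonlocalResolving-⊤))

module _ {n : ℕ} (G : Graph (Fin n)) where

  IsEdge : Pred (Fin n × Fin n) 0ℓ
  IsEdge (u , v) = u < v × Adj G u v

  isEdge? : Decidable IsEdge
  isEdge? (u , v) = (u <? v) ×-dec adj? G u v

  -- Every edge occurs once, as the pair of its ends in increasing order;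
  -- sets of edges are subsets of the positions in this list.
  edges : List (Fin n × Fin n)
  edges = filter isEdge? (cartesianProduct (allFin n) (allFin n))

  Incident : Fin n → Fin n × Fin n → Set
  Incident w (u , v) = w ≡ u ⊎ w ≡ v

  IsEdgeCover : Pred (Subset (length edges)) 0ℓ
  IsEdgeCover S = ∀ w → ∃ λ e → e ∈ S × Incident w (lookup edges e)

  isEdgeCover? : Decidable IsEdgeCover
  isEdgeCover? S = all? λ w → any? λ e →
    (e ∈? S) ×-dec ((w ≟ proj₁ (lookup edges e)) ⊎-dec (w ≟ proj₂ (lookup edges e)))

  ∈-edges : ∀ {u v} → IsEdge (u , v) → (u , v) ∈ˡ edges
  ∈-edges {u} {v} = ∈-filter⁺ isEdge? (∈-cartesianProduct⁺ (∈-allFin u) (∈-allFin v))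

  incidentEdge : ∀ {w v} → Adj G w v → ∃ λ e → Incident w (lookup edges e)
  incidentEdge {w} {v} a with <-cmp w v
  ... | tri< w<v _ _  = let p = ∈-edges (w<v , a) in
                        index p , inj₁ (cong proj₁ (lookup-index p))
  ... | tri≈ _ w≡v _  = contradiction a (irrefl G w≡v)
  ... | tri> _ _ v<w  = let p = ∈-edges (v<w , symm G a) in
                        index p , inj₂ (cong proj₂ (lookup-index p))

  another : 2 ≤ n → (w : Fin n) → ∃ λ v → w ≢ v
  another (s≤s (s≤s _)) zero    = suc zero , λ ()
  another (s≤s (s≤s _)) (suc _) = zero , λ ()

  neighbour : Connected G → 2 ≤ n → ∀ w → ∃ (Adj G w)
  neighbour conn 2≤n w with another 2≤n w
  ... | v , w≢v with conn w v
  ...   | zero  , (x ∷ [])     , _                   , refl , refl = contradiction refl w≢v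
  ...   | suc k , (x ∷ y ∷ xs) , (a ∷ _ , _) , refl , _    = y , a

  isEdgeCover-⊤ : Connected G → 2 ≤ n → IsEdgeCover ⊤
  isEdgeCover-⊤ conn 2≤n w =
    let e , inc = incidentEdge (proj₂ (neighbour conn 2≤n w)) in e , ∈⊤ , inc

  -- The hypotheses guarantee that an edge cover exists.
  edgeCoverNumber : Connected G → 2 ≤ n → ℕ
  edgeCoverNumber conn 2≤n = proj₁ (minSize isEdgeCover? (⊤ , isEdgeCover-⊤ conn 2≤n))

-- The star K_{1,m} with the edges in S subdivided once; the edges of the
-- star are identified with its leaves.
module _ {m : ℕ} (S : Subset m) where

  data StarVertex : Set where
    centre : StarVertex
    leaf   : Fin m → StarVertex
    mid    : (i : Fin m) → i ∈ S → StarVertex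

  data StarEdge : Rel StarVertex 0ℓ where
    whole : ∀ {i} → i ∉ S → StarEdge centre (leaf i)
    inner : ∀ {i p} → StarEdge centre (mid i p)
    outer : ∀ {i p} → StarEdge (mid i p) (leaf i)

  starEdge? : Decidable₂ StarEdge
  starEdge? centre    centre    = no λ ()
  starEdge? centre    (leaf i)  = map′ whole (λ where (whole q) → q) (¬? (i ∈? S))
  starEdge? centre    (mid i p) = yes inner
  starEdge? (leaf _)  _         = no λ ()
  starEdge? (mid i p) centre    = no λ ()
  starEdge? (mid i p) (leaf j)  = map′ (λ where refl → outer) (λ where outer → refl) (i ≟ j)
  starEdge? (mid i p) (mid j q) = no λ ()

  subdividedStar : Graph StarVertex
  subdividedStar = record
    { Adj    = SymClosure StarEdge
    ; adj?   = λ u v → map′ (λ where (inj₁ e) → fwd e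
                                     (inj₂ e) → bwd e)
                            (λ where (fwd e) → inj₁ e
                                     (bwd e) → inj₂ e)
                            (starEdge? u v ⊎-dec starEdge? v u)
    ; symm   = symmetric StarEdge
    ; irrefl = λ where refl (fwd ())
                       refl (bwd ())
    }

IsPartlySubdividedStar : ∀ {V} → Graph V → Set
IsPartlySubdividedStar G =
  ∃ λ m → 1 ≤ m × ∃ λ (S : Subset m) → (∃ λ kept → kept ∉ S) × G ≅ subdividedStar S

{-# OPTIONS --safe #-}
module Submission where

-- In a minimum edge cover S every edge has an end covered by no other edge of S.
-- Fix e₀ ∈ S and let X consist of one such private end of each other edge. A vertex
-- outside X is the centre of a star of S with a leaf in X, or an end of e₀ only; two
-- non-adjacent ones with equal distances to X would lie on a triangle or a square.
--
-- In a tree, X is resolving as soon as it meets, for every vertex m, all but at most one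
-- of the components of G − m. So all leaves but one resolve, and all leaves but two do
-- if the dropped ones hang at distinct vertices of degree at least 3. Since the leaves
-- inject into S, equality forces every vertex to be a leaf or adjacent to one and at
-- most one vertex to have degree at least 3, which leaves the partly subdivided stars.
-- Conversely, a nonlocal resolving set of such a star meets all legs but at most one,
-- and the edges at its leaves form an edge cover.

open import Data.Empty using (⊥)
open import Data.Fin using (Fin; zero; suc; fromℕ<)
open import Data.Fin.Properties using (_≟_; any?; all?; <-cmp; injective⇒≤; suc-injective; 0≢1+n)
open import Data.Fin.Subset using (Subset; _∈_; _∉_; ∣_∣; ⊤; ⁅_⁆; _─_; _-_; inside; outside)
open import Data.Fin.Subset.Properties using (_∈?_; ∈⊤; ∣⊤∣≡n; x∈⁅x⁆; p─q⊆p; x∈p∧x≢y⇒x∈p-y; x∈p⇒∣p-x∣<∣p∣)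
open import Data.List using (List; _∷_; length; lookup; filter; cartesianProduct; allFin)
open import Data.List.Membership.Propositional.Properties using (∈-filter⁻; ∈-filter⁺; ∈-lookup; ∈-allFin)
open import Data.List.Relation.Unary.Any using (index)
open import Data.List.Relation.Unary.Any.Properties using (lookup-index)
import Data.List.Relation.Unary.All as All
open import Data.List.Relation.Unary.AllPairs using (_∷_)
open import Data.List.Relation.Unary.Unique.Propositional using () renaming (Unique to Uniqueˡ)
open import Data.List.Relation.Unary.Unique.Propositional.Properties using (allFin⁺; filter⁺)
open import Data.Maybe using (Maybe; just; nothing)
open import Data.Maybe.Properties using (just-injective; ≡-dec)
open import Data.Nat using (ℕ; zero; suc; _≤_; _<_; _+_; z≤n; s≤s; s≤s⁻¹)
open import Data.Nat.Properties using (≤-refl; ≤-trans; ≤-antisym; ≤-reflexive; <-irrefl; <-≤-trans; ≤-<-trans; n<1+n; m≤n⇒m≤1+n; <⇒≤; <⇒≱; +-comm; +-suc; +-monoʳ-≤; m≤m+n; <-trans; <-asym; module ≤-Reasoning) renaming (_≟_ to _≟ᴺ_; <-cmp to <-cmpᴺ; suc-injective to suc-injectiveᴺ)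
open import Data.Product using (∃; _×_; _,_; proj₁; proj₂)
open import Data.Sum using (_⊎_; inj₁; inj₂)
open import Data.Vec using (Vec; []; _∷_; head; last; here; there; tabulate) renaming (lookup to lookupᵛ)
open import Data.Vec.Properties using (lookup⇒[]=; []=⇒lookup; lookup∘tabulate)
open import Data.Vec.Relation.Unary.All using (All; []; _∷_)
open import Data.Vec.Relation.Unary.AllPairs using ([]; _∷_)
open import Data.Vec.Relation.Unary.Linked using ([-]; _∷_)
open import Data.Vec.Relation.Unary.Unique.Propositional.Properties using (lookup-injective)
open import Data.Vec.Properties.WithK using ([]=-irrelevant)
open import Function.Base using (_∘_)
open import Function.Bundles using (_⇔_; _⤖_; mk⇔; mk⤖; Inverse; Equivalence)
open import Function.Properties.Bijection using (⤖⇒↔)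
open import Function.Properties.Inverse using (↔-sym)
open import Level using (0ℓ)
open import Relation.Binary using (tri<; tri≈; tri>)
open import Relation.Binary.Construct.Add.Supremum.NonStrict _≤_ using (_≤⁺_) renaming ([_] to [_]⁺)
open import Relation.Binary.Construct.Closure.Symmetric using (fwd; bwd)
open import Relation.Binary.PropositionalEquality using (_≡_; _≢_; refl; sym; trans; cong; subst; subst₂; ≢-sym)
open import Relation.Nullary using (¬_; Dec; yes; no; does; contradiction; _×-dec_; _⊎-dec_; _→-dec_; ¬?)
open import Relation.Nullary.Decidable using (dec-true; decidable-stable)
open import Relation.Nullary.Construct.Add.Supremum using ([_])
open import Relation.Unary using (Pred; Decidable)
open import Defs

-- Subsets of `Fin n` and counting

module _ {n : ℕ} {P : Pred (Fin n) 0ℓ} (P? : Decidable P) where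

  comprehension : Subset n
  comprehension = tabulate (λ i → does (P? i))

  ∈-comprehension⁺ : ∀ {i} → P i → i ∈ comprehension
  ∈-comprehension⁺ {i} p =
    lookup⇒[]= i comprehension (trans (lookup∘tabulate _ i) (dec-true (P? i) p))

  ∈-comprehension⁻ : ∀ {i} → i ∈ comprehension → P i
  ∈-comprehension⁻ {i} i∈ with P? i | trans (sym (lookup∘tabulate _ i)) ([]=⇒lookup i∈)
  ... | yes p | _ = p

x∈q⇒x∉p─q : ∀ {n} {x : Fin n} {p q} → x ∈ q → x ∉ p ─ q
x∈q⇒x∉p─q {p = _ ∷ p} {inside ∷ q}  here        ()
x∈q⇒x∉p─q {p = _ ∷ p} {inside ∷ q}  (there x∈q) (there r) = x∈q⇒x∉p─q x∈q r
x∈q⇒x∉p─q {p = _ ∷ p} {outside ∷ q} (there x∈q) (there r) = x∈q⇒x∉p─q x∈q r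

x∈p-y⇒x≢y : ∀ {n} {x y : Fin n} {p} → x ∈ p - y → x ≢ y
x∈p-y⇒x≢y {x = x} {p = p} x∈p-y refl = x∈q⇒x∉p─q {p = p} (x∈⁅x⁆ x) x∈p-y

x∈p-y⇒x∈p : ∀ {n} {x y : Fin n} {p} → x ∈ p - y → x ∈ p
x∈p-y⇒x∈p {y = y} {p} = p─q⊆p p ⁅ y ⁆

-- Each element of `p` uses up its image in `q`. The map `f` also receives the membership proof, so
-- it may return a witness extracted from it.
injection⇒∣p∣≤∣q∣ : ∀ {n k} (p : Subset n) (q : Subset k) (f : ∀ i → i ∈ p → Fin k) →
  (∀ i i∈p → f i i∈p ∈ q) → (∀ i j i∈p j∈p → f i i∈p ≡ f j j∈p → i ≡ j) → ∣ p ∣ ≤ ∣ q ∣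
injection⇒∣p∣≤∣q∣ []            q f f∈ inj = z≤n
injection⇒∣p∣≤∣q∣ (outside ∷ p) q f f∈ inj =
  injection⇒∣p∣≤∣q∣ p q (λ i i∈p → f (suc i) (there i∈p)) (λ i i∈p → f∈ _ _)
    (λ i j i∈p j∈p eq → suc-injective (inj _ _ _ _ eq))
injection⇒∣p∣≤∣q∣ (inside ∷ p)  q f f∈ inj = ≤-trans (s≤s
  (injection⇒∣p∣≤∣q∣ p (q - f zero here) (λ i i∈p → f (suc i) (there i∈p))
    (λ i i∈p → x∈p∧x≢y⇒x∈p-y (f∈ _ _) (λ eq → 0≢1+n (sym (inj _ _ _ _ eq))))
    (λ i j i∈p j∈p eq → suc-injective (inj _ _ _ _ eq))))
  (x∈p⇒∣p-x∣<∣p∣ (f∈ zero here))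

-- Short cycles and girth

triangle-free : ∀ {V} {G : Graph V} → ¬ CycleOfLength G 3 →
  ∀ {a b c} → Adj G a b → Adj G b c → Adj G c a → ⊥
triangle-free {G = G} ¬c {a} {b} {c} ab bc ca =
  ¬c (a ∷ b ∷ c ∷ [] ,
      (ab ∷ bc ∷ [-] ,
       ((λ e → irrefl G e ab) ∷ (λ e → irrefl G (sym e) ca) ∷ []) ∷ ((λ e → irrefl G e bc) ∷ []) ∷ [] ∷ []) ,
      ca)

square-free : ∀ {V} {G : Graph V} → ¬ CycleOfLength G 4 →
  ∀ {a b c d} → a ≢ c → b ≢ d → Adj G a b → Adj G b c → Adj G c d → Adj G d a → ⊥
square-free {G = G} ¬c {a} {b} {c} {d} a≢c b≢d ab bc cd da =
  ¬c (a ∷ b ∷ c ∷ d ∷ [] ,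
      (ab ∷ bc ∷ cd ∷ [-] ,
       ((λ e → irrefl G e ab) ∷ a≢c ∷ (λ e → irrefl G (sym e) da) ∷ []) ∷
       ((λ e → irrefl G e bc) ∷ b≢d ∷ []) ∷ ((λ e → irrefl G e cd) ∷ []) ∷ [] ∷ []) ,
      da)

girth-bound : ∀ {n} (G : Graph (Fin n)) {g} → [ g ] ≤⁺ girth G → ∀ {k} → k < g → ¬ CycleOfLength G k
girth-bound G g≤ {k} k<g c with hasCycle? G
girth-bound G [ g≤ ]⁺ {k} k<g c | yes c′ =
  <⇒≱ k<g (≤-trans g≤ (proj₂ (proj₂ (least (cycleOfLength? G) c′)) k c))
... | no ¬c = ¬c (k , c)

-- Walks and distance

module _ {V : Set} (G : Graph V) where

  data Walk : V → V → ℕ → Set where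
    stop : ∀ {u} → Walk u u 0
    step : ∀ {u v w k} → Adj G u v → Walk v w k → Walk u w (suc k)

module _ {V : Set} {G : Graph V} where

  walk-snoc : ∀ {u v w k} → Walk G u v k → Adj G v w → Walk G u w (suc k)
  walk-snoc stop       a = step a stop
  walk-snoc (step b p) a = step b (walk-snoc p a)

  walk-reverse : ∀ {u v k} → Walk G u v k → Walk G v u k
  walk-reverse stop       = stop
  walk-reverse (step a p) = walk-snoc (walk-reverse p) (symm G a)

  path⇒walk : ∀ {u v k} → PathOfLength G u v k → Walk G u v k
  path⇒walk {k = zero}  (x ∷ [] , _ , refl , refl) = stop
  path⇒walk {k = suc k} (x ∷ xs@(_ ∷ _) , (a ∷ l , _ ∷ u) , refl , eq) =
    step a (path⇒walk (xs , (l , u) , refl , eq))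

  -- Combined with connectedness: a set of vertices that is closed under adjacency and contains one
  -- vertex contains all.
  walk-closed : {P : Pred V 0ℓ} → (∀ {u v} → Adj G u v → P u → P v) →
    ∀ {u v k} → Walk G u v k → P u → P v
  walk-closed cl stop       pu = pu
  walk-closed cl (step a p) pu = walk-closed cl p (cl a pu)

module _ {n : ℕ} {G : Graph (Fin n)} where

  -- If `u` already lies on the path, the part from its occurrence on is a path from `u`; otherwise
  -- `u` is prepended.
  path-extend : ∀ {u w v k} → Adj G u w → PathOfLength G w v k →
    ∃ λ j → j ≤ suc k × PathOfLength G u v j
  path-extend {u} a (xs@(_ ∷ _) , π@(l , uq) , refl , refl) with suffix _ xs π
    where
    suffix : ∀ j (ys : Vec (Fin n) (suc j)) → IsPath G ys →
      (∃ λ i → i ≤ j × PathOfLength G u (last ys) i) ⊎ All (u ≢_) ys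
    suffix j (y ∷ ys) p with u ≟ y
    ... | yes refl = inj₁ (j , ≤-refl , y ∷ ys , p , refl , refl)
    suffix zero    (y ∷ [])         p | no u≢y = inj₂ (u≢y ∷ [])
    suffix (suc j) (y ∷ ys@(_ ∷ _)) (_ ∷ l , _ ∷ uq) | no u≢y with suffix j ys (l , uq)
    ... | inj₁ (i , i≤j , q) = inj₁ (i , m≤n⇒m≤1+n i≤j , q)
    ... | inj₂ u∉ys          = inj₂ (u≢y ∷ u∉ys)
  ... | inj₁ (i , i≤k , ρ) = i , m≤n⇒m≤1+n i≤k , ρ
  ... | inj₂ u∉xs          = _ , ≤-refl , u ∷ xs , (a ∷ l , u∉xs ∷ uq) , refl , refl

  walk⇒path : ∀ {u v k} → Walk G u v k → ∃ λ j → j ≤ k × PathOfLength G u v j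
  walk⇒path {u} stop = 0 , z≤n , u ∷ [] , ([-] , [] ∷ []) , refl , refl
  walk⇒path (step a p) with walk⇒path p
  ... | j , j≤k , π with path-extend a π
  ...   | i , i≤1+j , ρ = i , ≤-trans i≤1+j (s≤s j≤k) , ρ

module Distance {n : ℕ} (G : Graph (Fin n)) (conn : Connected G) where

  d : Fin n → Fin n → ℕ
  d = dist G conn

  geodesic : ∀ u v → Walk G u v (d u v)
  geodesic u v = path⇒walk (proj₁ (proj₂ (least (pathOfLength? G u v) (conn u v))))

  d≤walk : ∀ {u v k} → Walk G u v k → d u v ≤ k
  d≤walk {u} {v} p with walk⇒path p
  ... | j , j≤k , π = ≤-trans (proj₂ (proj₂ (least (pathOfLength? G u v) (conn u v))) j π) j≤k

  -- The `d u v + 1` vertices of a shortest path are distinct. This bounds the search for a leaf in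
  -- `leaf-beyond′`.
  d<n : ∀ u v → d u v < n
  d<n u v with proj₁ (proj₂ (least (pathOfLength? G u v) (conn u v)))
  ... | xs , (_ , uq) , _ = injective⇒≤ {f = lookupᵛ xs} (λ {i} {j} → lookup-injective uq i j)

  d-self : ∀ u → d u u ≡ 0
  d-self = dist-self G conn

  d≡0⇒≡ : ∀ {u v} → d u v ≡ 0 → u ≡ v
  d≡0⇒≡ = dist≡0⇒≡ G conn _ _

  d-sym : ∀ u v → d u v ≡ d v u
  d-sym u v = ≤-antisym (d≤walk (walk-reverse (geodesic v u))) (d≤walk (walk-reverse (geodesic u v)))

  d-step : ∀ {u v} x → Adj G u v → d u x ≤ suc (d v x)
  d-step x a = d≤walk (step a (geodesic _ x))

  parent : ∀ {u x k} → d u x ≡ suc k → ∃ λ w → Adj G u w × d w x ≡ k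
  parent {u} {x} eq with subst (Walk G u x) eq (geodesic u x)
  ... | step {v = w} a p =
    w , a , ≤-antisym (d≤walk p) (s≤s⁻¹ (subst (_≤ suc (d w x)) eq (d-step x a)))

  d-adj : ∀ {u v} → Adj G u v → d u v ≡ 1
  d-adj {u} {v} a with d u v in eq | d≤walk (step a stop)
  ... | zero        | _         = contradiction a (irrefl G (d≡0⇒≡ eq))
  ... | suc zero    | _         = refl
  ... | suc (suc _) | s≤s ()

  d≡1⇒adj : ∀ {u v} → d u v ≡ 1 → Adj G u v
  d≡1⇒adj {u} {v} eq with parent eq
  ... | w , a , eq′ = subst (Adj G u) (d≡0⇒≡ eq′) a

  resolves-self : ∀ {X u v} → u ∈ X → u ≢ v → Resolves G conn X u v
  resolves-self {u = u} u∈X u≢v =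
    u , u∈X , λ eq → u≢v (sym (d≡0⇒≡ (trans (sym eq) (d-self u))))

  resolves-sym : ∀ {X u v} → Resolves G conn X u v → Resolves G conn X v u
  resolves-sym (x , x∈X , ne) = x , x∈X , ≢-sym ne

  nonlocalDim≤ : ∀ X → NonlocalResolving G conn X → nonlocalDim G conn ≤ ∣ X ∣
  nonlocalDim≤ X r = proj₂ (proj₂ (minSize (nonlocalResolving? G conn) (⊤ , nonlocalResolving-⊤ G conn))) _ (X , r , refl)

  nonlocalBasis : ∃ λ X → NonlocalResolving G conn X × ∣ X ∣ ≡ nonlocalDim G conn
  nonlocalBasis = proj₁ (proj₂ (minSize (nonlocalResolving? G conn) (⊤ , nonlocalResolving-⊤ G conn)))

  resolves-unless-equidistant : ∀ {X u v} → ¬ (∀ x → x ∈ X → d u x ≡ d v x) → Resolves G conn X u v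
  resolves-unless-equidistant {X} {u} {v} h with any? (λ x → (x ∈? X) ×-dec ¬? (d u x ≟ᴺ d v x))
  ... | yes r = r
  ... | no ¬r = contradiction
    (λ x x∈X → decidable-stable (d u x ≟ᴺ d v x) (λ ne → ¬r (x , x∈X , ne))) h

-- Edge covers and incidence

module _ {n : ℕ} (G : Graph (Fin n)) (conn : Connected G) (2≤n : 2 ≤ n) where

  edgeCoverNumber≤ : ∀ S → IsEdgeCover G S → edgeCoverNumber G conn 2≤n ≤ ∣ S ∣
  edgeCoverNumber≤ S c = proj₂ (proj₂ (minSize (isEdgeCover? G) (⊤ , isEdgeCover-⊤ G conn 2≤n))) _ (S , c , refl)

  minimumEdgeCover : ∃ λ S → IsEdgeCover G S × ∣ S ∣ ≡ edgeCoverNumber G conn 2≤n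
  minimumEdgeCover = proj₁ (proj₂ (minSize (isEdgeCover? G) (⊤ , isEdgeCover-⊤ G conn 2≤n)))

module _ {n : ℕ} (G : Graph (Fin n)) where

  Edge : Set
  Edge = Fin (length (edges G))

  Touches : Fin n → Edge → Set
  Touches w e = Incident G w (lookup (edges G) e)

  touches? : ∀ w e → Dec (Touches w e)
  touches? w e = (w ≟ _) ⊎-dec (w ≟ _)

  ends-adj : ∀ e → Adj G (proj₁ (lookup (edges G) e)) (proj₂ (lookup (edges G) e))
  ends-adj e = proj₂ (proj₂ (∈-filter⁻ (isEdge? G) {xs = cartesianProduct (allFin n) (allFin n)} (∈-lookup {xs = edges G} e)))

  incident⇒adj : ∀ {u v} e → Touches u e → Touches v e → u ≢ v → Adj G u v
  incident⇒adj e (inj₁ p) (inj₁ q) u≢v = contradiction (trans p (sym q)) u≢v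
  incident⇒adj e (inj₁ refl) (inj₂ refl) u≢v = ends-adj e
  incident⇒adj e (inj₂ refl) (inj₁ refl) u≢v = symm G (ends-adj e)
  incident⇒adj e (inj₂ p) (inj₂ q) u≢v = contradiction (trans p (sym q)) u≢v

  adj⇒edge : ∀ {u v} → Adj G u v → ∃ λ e → Touches u e × Touches v e
  adj⇒edge {u} {v} a with <-cmp u v
  ... | tri< u<v _ _ = let p = ∈-edges G (u<v , a) in
                       index p , inj₁ (cong proj₁ (lookup-index p)) , inj₂ (cong proj₂ (lookup-index p))
  ... | tri≈ _ u≡v _ = contradiction a (irrefl G u≡v)
  ... | tri> _ _ v<u = let p = ∈-edges G (v<u , symm G a) in
                       index p , inj₂ (cong proj₂ (lookup-index p)) , inj₁ (cong proj₁ (lookup-index p))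

  other-end : ∀ {w} e → Touches w e → ∃ λ v → Touches v e × Adj G w v × (∀ u → Touches u e → u ≢ w → u ≡ v)
  other-end e (inj₁ refl) = _ , inj₂ refl , ends-adj e , λ where
    u (inj₁ p) ne → contradiction p ne
    u (inj₂ p) ne → p
  other-end e (inj₂ refl) = _ , inj₁ refl , symm G (ends-adj e) , λ where
    u (inj₁ p) ne → p
    u (inj₂ p) ne → contradiction p ne

-- The bound by the edge cover number

module MinimumEdgeCover {n : ℕ} (G : Graph (Fin n)) (conn : Connected G) (vertex : Fin n)
  (¬c₃ : ¬ CycleOfLength G 3) (¬c₄ : ¬ CycleOfLength G 4)
  (S : Subset (length (edges G))) (cover : IsEdgeCover G S)
  (minimum : ∀ T → IsEdgeCover G T → ∣ S ∣ ≤ ∣ T ∣) where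

  open Distance G conn

  Private : Fin n → Edge G → Set
  Private w e = ∀ f → f ∈ S → Touches G w f → f ≡ e

  shared-or-private : ∀ w e → (∃ λ f → f ∈ S × Touches G w f × f ≢ e) ⊎ Private w e
  shared-or-private w e with any? (λ f → (f ∈? S) ×-dec touches? G w f ×-dec ¬? (f ≟ e))
  ... | yes s = inj₁ s
  ... | no ¬s = inj₂ λ f f∈S w⊣f → decidable-stable (f ≟ e) (λ f≢e → ¬s (f , f∈S , w⊣f , f≢e))

  -- Otherwise `S - e` would be a cover smaller than the minimum. A vertex missed by `S - e` is
  -- covered by `S`, hence by `e` alone.
  private-end : ∀ e → e ∈ S → ∃ λ w → Touches G w e × Private w e
  private-end e e∈S with any? (λ w → ¬? (any? λ f → (f ∈? S - e) ×-dec touches? G w f))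
  ... | no ¬u = contradiction
    (minimum (S - e) λ w →
      decidable-stable (any? λ f → (f ∈? S - e) ×-dec touches? G w f) (λ u → ¬u (w , u)))
    (<⇒≱ (x∈p⇒∣p-x∣<∣p∣ e∈S))
  ... | yes (w , ¬c) with cover w | shared-or-private w e
  ...   | _              | inj₁ (g , g∈S , w⊣g , g≢e) = contradiction (g , x∈p∧x≢y⇒x∈p-y g∈S g≢e , w⊣g) ¬c
  ...   | f , f∈S , w⊣f  | inj₂ pr = w , subst (Touches G w) (pr f f∈S w⊣f) w⊣f , pr

  e₀ : Edge G
  e₀ = proj₁ (cover vertex)

  e₀∈S : e₀ ∈ S
  e₀∈S = proj₁ (proj₂ (cover vertex))

  -- If both ends of e are private, either could represent e; in absence of
  -- triangles and squares at least one of them has no neighbour on e₀.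
  IsRepresentative : Edge G → Fin n → Set
  IsRepresentative e b = Touches G b e × Private b e ×
    (∀ u v → Touches G u e₀ → Touches G v e → v ≢ b → Private v e → ¬ Adj G u b)

  -- A private end `p` without neighbour on `e₀` qualifies at once, and so does `p` if the other end
  -- `q` is shared, for then the condition on a private other end is void. In the remaining case `q`
  -- is private too and is taken instead.
  representative : ∀ e → e ∈ S - e₀ → ∃ (IsRepresentative e)
  representative e e∈ with private-end e (x∈p-y⇒x∈p e∈)
  ... | p , p⊣e , pr with other-end G e p⊣e | any? (λ u → touches? G u e₀ ×-dec adj? G u p)
  ...   | _ | no ¬near = p , p⊣e , pr , λ u v u⊣e₀ _ _ _ a → ¬near (u , u⊣e₀ , a)
  ...   | q , q⊣e , pq , uniq | yes (u′ , u′⊣e₀ , u′p) with shared-or-private q e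
  ...     | inj₁ (f , f∈S , q⊣f , f≢e) = p , p⊣e , pr , λ u v _ v⊣e v≢p prv _ →
              f≢e (prv f f∈S (subst (λ z → Touches G z f) (sym (uniq v v⊣e v≢p)) q⊣f))
  ...     | inj₂ prq = q , q⊣e , prq , far
    where
    e≢e₀ : e₀ ≢ e
    e≢e₀ eq = x∈p-y⇒x≢y {p = S} e∈ (sym eq)
    far : ∀ u v → Touches G u e₀ → Touches G v e → v ≢ q → Private v e → ¬ Adj G u q
    -- The neighbours `u′` of `p` and `u` of `q` on `e₀` close a triangle if they coincide and a
    -- square otherwise; privacy keeps `p` and `q` off `e₀`.
    far u v u⊣e₀ _ _ _ uq with u ≟ u′
    ... | yes refl = triangle-free {G = G} ¬c₃ u′p pq (symm G uq)
    ... | no u≢u′  = square-free {G = G} ¬c₄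
      (λ where refl → e≢e₀ (prq e₀ e₀∈S u′⊣e₀)) (λ where refl → e≢e₀ (pr e₀ e₀∈S u⊣e₀))
      u′p pq (symm G uq) (incident⇒adj G e₀ u⊣e₀ u′⊣e₀ u≢u′)

  rep : Edge G → Fin n
  rep e with e ∈? S - e₀
  ... | yes e∈ = proj₁ (representative e e∈)
  -- A dummy value: only representatives of edges in `S - e₀` enter `X`.
  ... | no  _  = vertex

  rep-spec : ∀ {e} → e ∈ S - e₀ → IsRepresentative e (rep e)
  rep-spec {e} e∈ with e ∈? S - e₀
  ... | yes e∈′ = proj₂ (representative e e∈′)
  ... | no  e∉  = contradiction e∈ e∉

  represented? : Decidable (λ v → ∃ λ e → e ∈ S - e₀ × rep e ≡ v)
  represented? v = any? λ e → (e ∈? S - e₀) ×-dec (rep e ≟ v)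

  X : Subset n
  X = comprehension represented?

  ∣X∣<∣S∣ : ∣ X ∣ < ∣ S ∣
  ∣X∣<∣S∣ = ≤-<-trans
    (injection⇒∣p∣≤∣q∣ X (S - e₀) (λ v v∈X → proj₁ (∈-comprehension⁻ represented? v∈X))
      (λ v v∈X → proj₁ (proj₂ (∈-comprehension⁻ represented? v∈X)))
      (λ u v u∈X v∈X eq → trans (sym (proj₂ (proj₂ (∈-comprehension⁻ represented? u∈X))))
        (trans (cong rep eq) (proj₂ (proj₂ (∈-comprehension⁻ represented? v∈X))))))
    (x∈p⇒∣p-x∣<∣p∣ e₀∈S)

  rep∈X : ∀ {e} → e ∈ S - e₀ → rep e ∈ X
  rep∈X e∈ = ∈-comprehension⁺ represented? (_ , e∈ , refl)

  rep-injective : ∀ {e f} → e ∈ S - e₀ → f ∈ S - e₀ → rep e ≡ rep f → e ≡ f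
  rep-injective {e} {f} e∈ f∈ eq =
    proj₁ (proj₂ (rep-spec f∈)) e (x∈p-y⇒x∈p e∈) (subst (λ z → Touches G z e) eq (proj₁ (rep-spec e∈)))

  module _ {u v : Fin n} (u≢v : u ≢ v) (¬uv : ¬ Adj G u v) (u∉X : u ∉ X) (v∉X : v ∉ X)
           (same : ∀ x → x ∈ X → d u x ≡ d v x) where

    adj-rep : ∀ {w f} → w ∉ X → f ∈ S - e₀ → Touches G w f → Adj G w (rep f)
    adj-rep {f = f} w∉X f∈ w⊣f = incident⇒adj G f w⊣f (proj₁ (rep-spec f∈))
      λ eq → w∉X (subst (_∈ X) (sym eq) (rep∈X f∈))

    -- The representative of an edge at `v` is at distance 1 from `v`, hence also from `u`.
    u-adj-rep : ∀ {f} → f ∈ S - e₀ → Touches G v f → Adj G u (rep f)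
    u-adj-rep f∈ v⊣f = d≡1⇒adj (trans (same _ (rep∈X f∈)) (d-adj (adj-rep v∉X f∈ v⊣f)))

    v-adj-rep : ∀ {f} → f ∈ S - e₀ → Touches G u f → Adj G v (rep f)
    v-adj-rep f∈ u⊣f = d≡1⇒adj (trans (sym (same _ (rep∈X f∈))) (d-adj (adj-rep u∉X f∈ u⊣f)))

    -- Distinct `e` and `f` give the square `u`, `rep e`, `v`, `rep f`; a common edge would make `u`
    -- and `v` adjacent.
    one-each : ∀ {e f} → e ∈ S - e₀ → f ∈ S - e₀ → Touches G u e → Touches G v f → ⊥
    one-each {e} {f} e∈ f∈ u⊣e v⊣f with e ≟ f
    ... | yes refl = ¬uv (incident⇒adj G e u⊣e v⊣f u≢v)
    ... | no e≢f   = square-free {G = G} ¬c₄ u≢v (e≢f ∘ rep-injective e∈ f∈)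
      (adj-rep u∉X e∈ u⊣e) (symm G (v-adj-rep e∈ u⊣e)) (adj-rep v∉X f∈ v⊣f) (symm G (u-adj-rep f∈ v⊣f))

    two-at-v : ∀ {e f} → e ∈ S - e₀ → f ∈ S - e₀ → e ≢ f → Touches G v e → Touches G v f → ⊥
    two-at-v e∈ f∈ e≢f v⊣e v⊣f = square-free {G = G} ¬c₄ u≢v (e≢f ∘ rep-injective e∈ f∈)
      (u-adj-rep e∈ v⊣e) (symm G (adj-rep v∉X e∈ v⊣e)) (adj-rep v∉X f∈ v⊣f) (symm G (u-adj-rep f∈ v⊣f))

    -- If `v` is private to `f`, then `rep f` was chosen over another private end and so has no
    -- neighbour on `e₀`, yet `u` is one. Otherwise a second cover edge at `v` is `e₀`, which joins
    -- `u` to `v`, or yields a square.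
    only-e₀-at-u : ∀ {f} → Touches G u e₀ → f ∈ S - e₀ → Touches G v f → ⊥
    only-e₀-at-u {f} u⊣e₀ f∈ v⊣f with shared-or-private v f
    ... | inj₂ prv = proj₂ (proj₂ (rep-spec f∈)) u v u⊣e₀ v⊣f
                       (λ eq → v∉X (subst (_∈ X) (sym eq) (rep∈X f∈))) prv (u-adj-rep f∈ v⊣f)
    ... | inj₁ (g , g∈S , v⊣g , g≢f) with g ≟ e₀
    ...   | yes refl = ¬uv (incident⇒adj G e₀ u⊣e₀ v⊣g u≢v)
    ...   | no g≢e₀  = two-at-v (x∈p∧x≢y⇒x∈p-y g∈S g≢e₀) f∈ g≢f v⊣g v⊣f

  cover-cases : ∀ w → (∃ λ e → e ∈ S - e₀ × Touches G w e) ⊎ Touches G w e₀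
  cover-cases w with cover w
  ... | e , e∈S , w⊣e with e ≟ e₀
  ...   | yes refl = inj₂ w⊣e
  ...   | no e≢e₀  = inj₁ (e , x∈p∧x≢y⇒x∈p-y e∈S e≢e₀ , w⊣e)

  X-resolving : NonlocalResolving G conn X
  X-resolving u v u≢v ¬uv with u ∈? X | v ∈? X
  ... | yes u∈X | _       = resolves-self u∈X u≢v
  ... | no  _   | yes v∈X = resolves-sym (resolves-self v∈X (≢-sym u≢v))
  ... | no  u∉X | no  v∉X = resolves-unless-equidistant impossible
    where
    impossible : ¬ (∀ x → x ∈ X → d u x ≡ d v x)
    impossible same with cover-cases u | cover-cases v
    ... | inj₁ (e , e∈ , u⊣e) | inj₁ (f , f∈ , v⊣f) = one-each u≢v ¬uv u∉X v∉X same e∈ f∈ u⊣e v⊣f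
    ... | inj₂ u⊣e₀ | inj₁ (f , f∈ , v⊣f) = only-e₀-at-u u≢v ¬uv u∉X v∉X same u⊣e₀ f∈ v⊣f
    ... | inj₁ (e , e∈ , u⊣e) | inj₂ v⊣e₀ = only-e₀-at-u (≢-sym u≢v) (¬uv ∘ symm G) v∉X u∉X
                                               (λ x x∈X → sym (same x x∈X)) v⊣e₀ e∈ u⊣e
    ... | inj₂ u⊣e₀ | inj₂ v⊣e₀ = ¬uv (incident⇒adj G e₀ u⊣e₀ v⊣e₀ u≢v)

nonlocalDim<edgeCoverNumber : ∀ {n} (G : Graph (Fin n)) (conn : Connected G) (2≤n : 2 ≤ n) →
  ¬ CycleOfLength G 3 → ¬ CycleOfLength G 4 → nonlocalDim G conn < edgeCoverNumber G conn 2≤n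
nonlocalDim<edgeCoverNumber G conn 2≤n ¬c₃ ¬c₄ =
  let S , cover , ∣S∣≡β = minimumEdgeCover G conn 2≤n
      minimum T cT = ≤-trans (≤-reflexive ∣S∣≡β) (edgeCoverNumber≤ G conn 2≤n T cT)
      open MinimumEdgeCover G conn (fromℕ< (≤-trans (s≤s z≤n) 2≤n)) ¬c₃ ¬c₄ S cover minimum
  in ≤-<-trans (Distance.nonlocalDim≤ G conn X X-resolving) (<-≤-trans ∣X∣<∣S∣ (≤-reflexive ∣S∣≡β))

-- Trees

module _ {V : Set} (G : Graph V) where

  -- A condition on three consecutive vertices at a time, so walks can be glued from geodesics;
  -- acyclicity turns it into distinctness of all vertices.
  data NonBacktracking : ∀ {k} → Vec V k → Set where
    edge : ∀ {u v} → Adj G u v → NonBacktracking (u ∷ v ∷ [])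
    turn : ∀ {u v w k} {xs : Vec V k} → Adj G u v → u ≢ w →
      NonBacktracking (v ∷ w ∷ xs) → NonBacktracking (u ∷ v ∷ w ∷ xs)

module _ {n : ℕ} (G : Graph (Fin n)) (acyclic : Acyclic G) where

  -- The stretch of `xs` before an occurrence of `u`; it closes up to a cycle through `u`. That its
  -- vertices come from `xs` is phrased in `within` by avoidance, the form in which uniqueness
  -- proofs use it.
  record Return {k} (u : Fin n) (xs : Vec (Fin n) (suc k)) : Set where
    field
      {len}   : ℕ
      prefix  : Vec (Fin n) (suc len)
      isPath  : IsPath G prefix
      start   : head prefix ≡ head xs
      closing : Adj G (last prefix) u
      avoids  : All (u ≢_) prefix
      within  : ∀ {v} → All (v ≢_) xs → All (v ≢_) prefix

  return-or-avoid : ∀ {k} u (xs : Vec (Fin n) (suc k)) → IsPath G xs → u ≢ head xs →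
    Return u xs ⊎ All (u ≢_) xs
  return-or-avoid u (x ∷ [])     π u≢x = inj₂ (u≢x ∷ [])
  return-or-avoid u (x ∷ y ∷ xs) (a ∷ l , x∉ ∷ uq) u≢x with u ≟ y
  ... | yes refl = inj₁ record
    { prefix  = x ∷ []
    ; isPath  = [-] , [] ∷ []
    ; start   = refl
    ; closing = a
    ; avoids  = u≢x ∷ []
    ; within  = λ where (v≢x ∷ _) → v≢x ∷ []
    }
  ... | no u≢y with return-or-avoid u (y ∷ xs) (l , uq) u≢y
  ...   | inj₂ u∉ = inj₂ (u≢x ∷ u∉)
  ...   | inj₁ record { prefix = z ∷ zs ; isPath = l′ , uq′ ; start = refl ; closing = cl ; avoids = av ; within = wi } =
    inj₁ record
      { prefix  = x ∷ z ∷ zs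
      ; isPath  = a ∷ l′ , wi x∉ ∷ uq′
      ; start   = refl
      ; closing = cl
      ; avoids  = u≢x ∷ av
      ; within  = λ where (v≢x ∷ v∉) → v≢x ∷ wi v∉
      }

  -- If the newly prepended vertex `u` recurred, the stretch before its recurrence would close a
  -- cycle. Since `u ≢ w`, that cycle has at least three vertices.
  nonBacktracking⇒path : ∀ {k} {xs : Vec (Fin n) k} → NonBacktracking G xs → IsPath G xs
  nonBacktracking⇒path (edge a) = a ∷ [-] , ((λ e → irrefl G e a) ∷ []) ∷ [] ∷ []
  nonBacktracking⇒path {xs = u ∷ v ∷ w ∷ xs} (turn a u≢w p) with nonBacktracking⇒path p
  ... | b ∷ l , v∉ ∷ uq with return-or-avoid u (w ∷ xs) (l , uq) u≢w
  ...   | inj₂ u∉ = a ∷ b ∷ l , ((λ e → irrefl G e a) ∷ u∉) ∷ v∉ ∷ uq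
  ...   | inj₁ record { prefix = z ∷ zs ; isPath = l′ , uq′ ; start = refl ; closing = cl ; avoids = av ; within = wi } =
    contradiction
      (_ , u ∷ v ∷ z ∷ zs , (a ∷ b ∷ l′ , ((λ e → irrefl G e a) ∷ av) ∷ wi v∉ ∷ uq′) , cl) acyclic

module Tree {n : ℕ} (G : Graph (Fin n)) (conn : Connected G) (acyclic : Acyclic G) where

  open Distance G conn

  -- A geodesic followed parent by parent does not backtrack, because a grandparent is closer by
  -- two. The condition `¬ All (x ≢_)` records that it reaches `x`.
  descend : ∀ {x v} j → d v x ≡ suc j →
    ∃ λ p → d p x ≡ j × ∃ λ k → ∃ λ (xs : Vec (Fin n) k) →
      NonBacktracking G (v ∷ p ∷ xs) × ¬ All (x ≢_) (p ∷ xs)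
  descend zero eq with parent eq
  ... | p , a , eq′ = p , eq′ , 0 , [] , edge a , λ where (x≢p ∷ _) → x≢p (sym (d≡0⇒≡ eq′))
  descend {x} {v} (suc j) eq with parent eq
  ... | p , a , eq′ with descend j eq′
  ...   | q , eq″ , k , xs , nb , x∈ = p , eq′ , suc k , q ∷ xs , turn a v≢q nb , λ where (_ ∷ x∉) → x∈ x∉
    where
    v≢q : v ≢ q
    v≢q refl = <-irrefl (trans (sym eq″) eq) (m≤n⇒m≤1+n (n<1+n j))

  -- Prepending ever closer vertices makes the walk end where it started.
  no-ascent : ∀ {x u r k} {xs : Vec (Fin n) k} j → d u x ≡ j → d u x ≤ d r x →
    NonBacktracking G (u ∷ r ∷ xs) → ¬ All (x ≢_) (r ∷ xs) → ⊥
  no-ascent {x} zero eq le nb x∈ with d≡0⇒≡ eq | nonBacktracking⇒path G acyclic nb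
  ... | refl | _ , u∉ ∷ _ = x∈ u∉
  no-ascent {x} {u} {r} (suc j) eq le nb x∈ with parent eq
  ... | p , a , eq′ = no-ascent j eq′ (<⇒≤ p<u) (turn (symm G a) p≢r nb) λ where (_ ∷ x∉) → x∈ x∉
    where
    p<u : d p x < d u x
    p<u = ≤-reflexive (trans (cong suc eq′) (sym eq))
    p≢r : p ≢ r
    p≢r refl = <⇒≱ p<u le

  -- Trees are bipartite: with equal distances, the walk from `u` over `v` down to `x` does not
  -- backtrack, and a geodesic from `u` to `x`, prepended in reverse, would make it meet `x` twice.
  adj⇒d≢ : ∀ {u v x} → Adj G u v → d u x ≢ d v x
  adj⇒d≢ {u} {v} {x} a eq with d v x in eqv
  ... | zero  = irrefl G (trans (d≡0⇒≡ eq) (sym (d≡0⇒≡ eqv))) a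
  ... | suc j with descend j eqv
  ...   | p , eqp , _ , _ , nb , x∈ =
    no-ascent (suc j) eq (≤-reflexive (trans eq (sym eqv))) (turn a u≢p nb) λ where (_ ∷ x∉) → x∈ x∉
    where
    u≢p : u ≢ p
    u≢p refl = <-irrefl (trans (sym eqp) eq) (n<1+n j)

  adj⇒< : ∀ {u v} x → Adj G u v → d u x < d v x ⊎ d v x < d u x
  adj⇒< {u} {v} x a with <-cmpᴺ (d u x) (d v x)
  ... | tri< lt _ _ = inj₁ lt
  ... | tri≈ _ eq _ = contradiction eq (adj⇒d≢ a)
  ... | tri> _ _ gt = inj₂ gt

  adj∧<⇒≡suc : ∀ {u v x} → Adj G u v → d v x < d u x → d u x ≡ suc (d v x)
  adj∧<⇒≡suc {x = x} a lt = ≤-antisym (d-step x a) lt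

  -- Distinct parents would give the nonbacktracking walk `a`, `m`, `b` and down to `x`, besides a
  -- second way from `a` down to `x`; `no-ascent` excludes this.
  parent-unique : ∀ {m a b x} → Adj G m a → Adj G m b → d a x < d m x → d b x < d m x → a ≡ b
  parent-unique {m} {a} {b} {x} ma mb a<m b<m = decidable-stable (a ≟ b) λ a≢b → contra a≢b
    where
    eqa : d m x ≡ suc (d a x)
    eqa = adj∧<⇒≡suc ma a<m
    contra : a ≢ b → ⊥
    contra a≢b with d b x in eqb | adj∧<⇒≡suc mb b<m
    ... | zero  | eqm = a≢b (trans (d≡0⇒≡ (suc-injectiveᴺ (trans (sym eqa) eqm))) (sym (d≡0⇒≡ eqb)))
    ... | suc j | eqm with descend j eqb
    ...   | p , eqp , _ , _ , nb , x∈ = no-ascent _ refl (<⇒≤ a<m)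
      (turn (symm G ma) a≢b (turn mb m≢p nb)) λ where (_ ∷ _ ∷ x∉) → x∈ x∉
      where
      m≢p : m ≢ p
      m≢p refl = <-irrefl (trans (sym eqp) eqm) (m≤n⇒m≤1+n (n<1+n j))

  -- Only one neighbour of `m` is closer to `x`, and none is equally far.
  away : ∀ {m a b} x → Adj G m a → Adj G m b → a ≢ b → d a x < d m x → d m x < d b x
  away x ma mb a≢b a<m with adj⇒< x mb
  ... | inj₁ m<b = m<b
  ... | inj₂ b<m = contradiction (parent-unique ma mb a<m b<m) a≢b

  -- The component of G − m containing the neighbour a of m consists of the
  -- vertices z with d a z < d m z; these conditions play the role of components below.

  Dominates : (m a u v x : Fin n) → Set
  Dominates m a u v x = ∀ z → d a z < d m z →
    d u z < d v z × (∀ w → Adj G v w → d w x < d v x → d w z < d v z)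

  -- The path from `pv` to `z` starts towards `x`, hence not through `v`, so
  -- `d u z ≤ 1 + d pu z ≤ d pv z < d v z`. The second conjunct of `Dominates` carries this
  -- direction through the induction.
  dominates-step : ∀ {m a u v pu pv x} k → pu ≢ pv → Adj G u pu → Adj G v pv →
    d pu x ≡ k → d pv x ≡ k → d pv x < d v x →
    Dominates m a pu pv x → Dominates m a u v x
  dominates-step zero pu≢pv ua vb eqpu eq = contradiction (trans (d≡0⇒≡ eqpu) (sym (d≡0⇒≡ eq))) pu≢pv
  dominates-step {u = u} {v} {pu} {pv} {x} (suc k) pu≢pv ua vb eqpu eq pv<v dom z z∈ with dom z z∈ | parent eq
  ... | pu<pv , closer | w , pw , eqw =
    ≤-<-trans (≤-trans (d-step z ua) pu<pv) pv<vz , λ w′ vw′ w′<v →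
      subst (λ y → d y z < d v z) (parent-unique vb vw′ pv<v w′<v) pv<vz
    where
    w<pv : d w x < d pv x
    w<pv = ≤-reflexive (trans (cong suc eqw) (sym eq))
    w≢v : w ≢ v
    w≢v refl = <-asym w<pv pv<v
    pv<vz : d pv z < d v z
    pv<vz = away z pw (symm G vb) w≢v (closer w pw w<pv)

  dominates-base : ∀ {m u v x} → Adj G u m → Adj G v m → u ≢ v → d m x < d v x → Dominates m u u v x
  dominates-base {m} {u} {v} um vm u≢v m<v z u<m =
    <-trans u<m m<vz , λ w vw w<v → subst (λ y → d y z < d v z) (parent-unique vm vw m<v w<v) m<vz
    where
    m<vz : d m z < d v z
    m<vz = away z (symm G um) (symm G vm) u≢v u<m

  -- m is the midpoint of the path from u to v: the first common vertex of the geodesics to x.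
  midpoint : ∀ {u v x} k → u ≢ v → d u x ≡ k → d v x ≡ k →
    ∃ λ m → ∃ λ a → ∃ λ b → Adj G m a × Adj G m b × a ≢ b × Dominates m a u v x × Dominates m b v u x
  midpoint zero    u≢v equ eqv = contradiction (trans (d≡0⇒≡ equ) (sym (d≡0⇒≡ eqv))) u≢v
  midpoint {u} {v} {x} (suc k) u≢v equ eqv with parent equ | parent eqv
  ... | pu , ua , eqpu | pv , vb , eqpv with pu ≟ pv
  ...   | yes refl = pu , u , v , symm G ua , symm G vb , u≢v ,
    dominates-base ua vb u≢v (≤-reflexive (trans (cong suc eqpv) (sym eqv))) ,
    dominates-base vb ua (≢-sym u≢v) (≤-reflexive (trans (cong suc eqpu) (sym equ)))
  ...   | no pu≢pv with midpoint k pu≢pv eqpu eqpv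
  ...     | m , a , b , ma , mb , a≢b , dom₁ , dom₂ = m , a , b , ma , mb , a≢b ,
    dominates-step k pu≢pv ua vb eqpu eqpv (≤-reflexive (trans (cong suc eqpv) (sym eqv))) dom₁ ,
    dominates-step k (≢-sym pu≢pv) vb ua eqpv eqpu (≤-reflexive (trans (cong suc eqpu) (sym equ))) dom₂

  -- This asks that `X` meet all but at most one component of G - m, for every vertex m; components
  -- are named by the neighbours of m.
  HitsOneOfTwo : Subset n → Set
  HitsOneOfTwo X = ∀ m a b → Adj G m a → Adj G m b → a ≢ b →
    ∃ λ x → x ∈ X × (d a x < d m x ⊎ d b x < d m x)

  -- If `X` does not resolve `u` and `v`, they are equidistant from `x₀` and so have a midpoint.
  -- Each of the components on their two sides is closer to one of them, and `X` has a member in one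
  -- of these components.
  hitsOneOfTwo⇒resolving : ∀ X → (∃ λ x → x ∈ X) → HitsOneOfTwo X → NonlocalResolving G conn X
  hitsOneOfTwo⇒resolving X (x₀ , x₀∈X) hits u v u≢v _ = resolves-unless-equidistant contra
    where
    contra : ¬ (∀ x → x ∈ X → d u x ≡ d v x)
    contra same with midpoint _ u≢v (same x₀ x₀∈X) refl
    ... | m , a , b , ma , mb , a≢b , dom₁ , dom₂ with hits m a b ma mb a≢b
    ...   | x , x∈X , inj₁ near = <-irrefl (same x x∈X) (proj₁ (dom₁ x near))
    ...   | x , x∈X , inj₂ near = <-irrefl (sym (same x x∈X)) (proj₁ (dom₂ x near))

-- Leaves and branching vertices

module _ {n : ℕ} (G : Graph (Fin n)) where

  Leaf : Fin n → Set
  Leaf v = ∀ w w′ → Adj G v w → Adj G v w′ → w ≡ w′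

  leaf? : Decidable Leaf
  leaf? v = all? λ w → all? λ w′ → adj? G v w →-dec (adj? G v w′ →-dec (w ≟ w′))

  ¬leaf⇒neighbours : ∀ {v} → ¬ Leaf v → ∃ λ a → ∃ λ b → Adj G v a × Adj G v b × a ≢ b
  ¬leaf⇒neighbours {v} ¬l
    with any? (λ a → any? λ b → adj? G v a ×-dec adj? G v b ×-dec ¬? (a ≟ b))
  ... | yes r = r
  ... | no ¬r = contradiction
    (λ a b va vb → decidable-stable (a ≟ b) (λ a≢b → ¬r (a , b , va , vb , a≢b))) ¬l

  ¬leaf⇒other : ∀ {v} → ¬ Leaf v → ∀ m → ∃ λ w → Adj G v w × m ≢ w
  ¬leaf⇒other ¬l m with ¬leaf⇒neighbours ¬l
  ... | a , b , va , vb , a≢b with m ≟ a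
  ...   | yes refl = b , vb , a≢b
  ...   | no m≢a   = a , va , m≢a

  leaves : Subset n
  leaves = comprehension leaf?

  -- The set of `u` and `v` is closed under adjacency, so by connectedness it is the whole graph.
  adjacent-leaves : Connected G → ∀ {u v} → Leaf u → Leaf v → Adj G u v → ∀ w → Leaf w
  adjacent-leaves conn {u} {v} lu lv uv w
    with walk-closed {G = G} {P = λ y → y ≡ u ⊎ y ≡ v} closed (path⇒walk (proj₂ (conn u w))) (inj₁ refl)
    where
    closed : ∀ {y z} → Adj G y z → y ≡ u ⊎ y ≡ v → z ≡ u ⊎ z ≡ v
    closed yz (inj₁ refl) = inj₂ (lu _ _ yz uv)
    closed yz (inj₂ refl) = inj₁ (lv _ _ yz (symm G uv))
  ... | inj₁ refl = lu
  ... | inj₂ refl = lv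

  ThreeNeighbours : Fin n → Set
  ThreeNeighbours v = ∃ λ p → ∃ λ q → ∃ λ r →
    Adj G v p × Adj G v q × Adj G v r × p ≢ q × p ≢ r × q ≢ r

  threeNeighbours? : Decidable ThreeNeighbours
  threeNeighbours? v = any? λ p → any? λ q → any? λ r →
    adj? G v p ×-dec adj? G v q ×-dec adj? G v r ×-dec ¬? (p ≟ q) ×-dec ¬? (p ≟ r) ×-dec ¬? (q ≟ r)

  two-others : ∀ {v} → ThreeNeighbours v → ∀ x →
    ∃ λ q → ∃ λ r → Adj G v q × Adj G v r × q ≢ r × q ≢ x × r ≢ x
  two-others (p , q , r , vp , vq , vr , p≢q , p≢r , q≢r) x with p ≟ x | q ≟ x
  ... | yes refl | _        = q , r , vq , vr , q≢r , ≢-sym p≢q , ≢-sym p≢r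
  ... | no p≢x   | yes refl = p , r , vp , vr , p≢r , p≢x , ≢-sym q≢r
  ... | no p≢x   | no q≢x   = p , q , vp , vq , p≢q , p≢x , q≢x

-- Sets of leaves that resolve a tree

module TreeLeaves {n : ℕ} (G : Graph (Fin n)) (conn : Connected G) (acyclic : Acyclic G) where

  open Distance G conn
  open Tree G conn acyclic

  -- Moving from `a` ever farther from `r` stops at a leaf, because distances stay below `n`; `fuel`
  -- bounds the number of steps left. By `away`, the leaf lies beyond every vertex passed.
  leaf-beyond′ : ∀ fuel {m a} r → Adj G m a → d m r < d a r → n ≤ fuel + d a r →
    ∃ λ z → Leaf G z × d a z < d m z
  leaf-beyond′ zero       r ma m<a n≤ = contradiction n≤ (<⇒≱ (d<n _ r))
  leaf-beyond′ (suc fuel) {m} {a} r ma m<a n≤ with leaf? G a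
  ... | yes la = a , la , subst (_< d m a) (sym (d-self a)) (≤-reflexive (sym (d-adj ma)))
  ... | no ¬la with ¬leaf⇒other G ¬la m
  ...   | w , aw , m≢w
      with leaf-beyond′ fuel r aw a<w
             (≤-trans n≤ (≤-trans (≤-reflexive (sym (+-suc fuel (d a r)))) (+-monoʳ-≤ fuel a<w)))
    where
    a<w : d a r < d w r
    a<w = away r (symm G ma) aw m≢w m<a
  ...     | z , lz , w<a = z , lz , away z aw (symm G ma) (≢-sym m≢w) w<a

  leaf-beyond : ∀ {m a} → Adj G m a → ∃ λ z → Leaf G z × d a z < d m z
  leaf-beyond {m} {a} ma = leaf-beyond′ n m ma
    (subst (_< d a m) (sym (d-self m)) (≤-reflexive (sym (d-adj (symm G ma))))) (m≤m+n n _)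

  -- Two components at `m` contain distinct leaves, by uniqueness of parents, and at most one of
  -- these is `a`. The non-leaf `w` yields a member of the set.
  all-but-one-leaf-resolves : ∀ {w} a → ¬ Leaf G w → NonlocalResolving G conn (leaves G - a)
  all-but-one-leaf-resolves {w} a ¬lw with ¬leaf⇒neighbours G ¬lw
  ... | p , q , wp , wq , p≢q =
    hitsOneOfTwo⇒resolving _ (let x , x∈ , _ = hits w p q wp wq p≢q in x , x∈) hits
    where
    hits : HitsOneOfTwo (leaves G - a)
    hits m p q mp mq p≢q with leaf-beyond mp | leaf-beyond mq
    ... | y , ly , y∈p | z , lz , z∈q with y ≟ a
    ...   | no y≢a   = y , x∈p∧x≢y⇒x∈p-y (∈-comprehension⁺ (leaf? G) ly) y≢a , inj₁ y∈p
    ...   | yes refl = z , x∈p∧x≢y⇒x∈p-y (∈-comprehension⁺ (leaf? G) lz)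
                             (λ where refl → p≢q (parent-unique mp mq y∈p z∈q)) , inj₂ z∈q

  -- The path from `a` to `c` and on to `q` leads away from `m`, so everything beyond `q` at `c`
  -- stays in the component of `a` at `m`. The induction runs along the path from `a` to `c`.
  component-nested : ∀ k {m a c q z} → Adj G m a → d a c ≡ k → d a c < d m c →
    Adj G c q → d c m < d q m → d q z < d c z → d a z < d m z
  component-nested zero {m} {z = z} ma eq a<m cq c<q q<c with d≡0⇒≡ eq
  ... | refl = away z cq (symm G ma) (λ where refl → <⇒≱ c<q (≤-trans (≤-reflexive (d-self m)) z≤n)) q<c
  component-nested (suc k) {m} {a} {c} {q} {z} ma eq a<m cq c<q q<c with parent eq
  ... | b , ab , eqb = away z ab (symm G ma) b≢m (component-nested k ab eqb b<a cq c<q′ q<c)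
    where
    b<a : d b c < d a c
    b<a = ≤-reflexive (trans (cong suc eqb) (sym eq))
    b≢m : b ≢ m
    b≢m refl = <-asym b<a a<m
    c<q′ : d c a < d q a
    -- Moving from `m` to `a` brings `c` closer by at least one and `q` by at most one, so `q` stays
    -- behind `c`.
    c<q′ = s≤s⁻¹ (begin
      suc (suc (d c a)) ≡⟨ cong (λ t → suc (suc t)) (d-sym c a) ⟩
      suc (suc (d a c)) ≤⟨ s≤s a<m ⟩
      suc (d m c)       ≡⟨ cong suc (d-sym m c) ⟩
      suc (d c m)       ≤⟨ c<q ⟩
      d q m             ≡⟨ d-sym q m ⟩
      d m q             ≤⟨ d-step q ma ⟩
      suc (d a q)       ≡⟨ cong suc (d-sym a q) ⟩
      suc (d q a)       ∎)
      where open ≤-Reasoning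

  d-to-leaf : ∀ {x c v} → Leaf G x → Adj G x c → v ≢ x → d v x ≡ suc (d v c)
  d-to-leaf {x} {c} {v} lx xc v≢x with d x v in eq
  ... | zero  = contradiction (sym (d≡0⇒≡ eq)) v≢x
  ... | suc k with parent eq
  ...   | w , xw , eqw with lx _ _ xw xc
  ...     | refl = trans (d-sym v x) (trans eq (cong suc (trans (sym eqw) (d-sym c v))))

  -- A dropped leaf x is not the only leaf of a component at m ≠ c, since the
  -- component then contains c and with it one more branch at c.
  second-leaf : ∀ {x c m a} → Leaf G x → Adj G x c → ThreeNeighbours G c → m ≢ c →
    Adj G m a → d a x < d m x → ∃ λ z → Leaf G z × z ≢ x × d a z < d m z
  second-leaf {x} {c} {m} {a} lx xc three m≢c ma a<m with two-others G three x
  ... | q , r , cq , cr , q≢r , q≢x , r≢x = choose (adj⇒< m cq)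
    where
    m≢x : m ≢ x
    m≢x refl = <⇒≱ a<m (≤-trans (≤-reflexive (d-self m)) z≤n)
    a≢x : a ≢ x
    a≢x refl = m≢c (lx _ _ (symm G ma) xc)
    -- Both `a` and `m` reach the leaf `x` through `c`, so comparing distances to `x` amounts to
    -- comparing distances to `c`.
    a<m′ : d a c < d m c
    a<m′ = s≤s⁻¹ (begin-strict
      suc (d a c) ≡⟨ d-to-leaf lx xc a≢x ⟨
      d a x       <⟨ a<m ⟩
      d m x       ≡⟨ d-to-leaf lx xc m≢x ⟩
      suc (d m c) ∎)
      where open ≤-Reasoning
    via : ∀ {s} → Adj G c s → s ≢ x → d c m < d s m → ∃ λ z → Leaf G z × z ≢ x × d a z < d m z
    via cs s≢x c<s with leaf-beyond cs
    ... | z , lz , s<c = z , lz ,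
      (λ where refl → s≢x (parent-unique cs (symm G xc) s<c
                 (subst (_< d c x) (sym (d-self x)) (≤-reflexive (sym (d-adj (symm G xc))))))) ,
      component-nested _ ma refl a<m′ cs c<s s<c
    -- At most one of `q` and `r` is closer to `m` than `c` is; the other one leads away from `m`.
    choose : d c m < d q m ⊎ d q m < d c m → ∃ λ z → Leaf G z × z ≢ x × d a z < d m z
    choose (inj₁ c<q) = via cq q≢x c<q
    choose (inj₂ q<c) = via cr r≢x (away m cq cr q≢r q<c)

  -- The critical case is that the leaves found in two components at `m` are exactly `x` and `y`. As
  -- `c ≢ e`, the vertex `m` differs from `c` or from `e`, and `second-leaf` supplies a further leaf
  -- in one component; it is not the other dropped leaf, which lies in the other component.
  all-but-two-leaves-resolve : ∀ {x c y e} → Leaf G x → Adj G x c → ThreeNeighbours G c →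
    Leaf G y → Adj G y e → ThreeNeighbours G e → c ≢ e → NonlocalResolving G conn (leaves G - x - y)
  all-but-two-leaves-resolve {x} {c} {y} {e} lx xc three₁@(p , q , _ , cp , cq , _ , p≢q , _) ly ye three₂ c≢e =
    hitsOneOfTwo⇒resolving _ (let z , z∈ , _ = hits c p q cp cq p≢q in z , z∈) hits
    where
    kept : ∀ {z} → Leaf G z → z ≢ x → z ≢ y → z ∈ leaves G - x - y
    kept lz z≢x z≢y = x∈p∧x≢y⇒x∈p-y (x∈p∧x≢y⇒x∈p-y (∈-comprehension⁺ (leaf? G) lz) z≢x) z≢y
    separated : ∀ {m a b} → Adj G m a → Adj G m b → a ≢ b → d a x < d m x → d b y < d m y →
      ∃ λ z → z ∈ leaves G - x - y × (d a z < d m z ⊎ d b z < d m z)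
    separated {m} ma mb a≢b x∈a y∈b with m ≟ c
    ... | no m≢c with second-leaf lx xc three₁ m≢c ma x∈a
    ...   | z , lz , z≢x , z∈a =
      z , kept lz z≢x (λ where refl → a≢b (parent-unique ma mb z∈a y∈b)) , inj₁ z∈a
    separated {m} ma mb a≢b x∈a y∈b | yes refl with second-leaf ly ye three₂ c≢e mb y∈b
    ... | z , lz , z≢y , z∈b =
      z , kept lz (λ where refl → a≢b (parent-unique ma mb x∈a z∈b)) z≢y , inj₂ z∈b
    hits : HitsOneOfTwo (leaves G - x - y)
    hits m a b ma mb a≢b with leaf-beyond ma | leaf-beyond mb
    ... | s , ls , s∈a | t , lt , t∈b with s ≟ x | s ≟ y | t ≟ x | t ≟ y
    ... | no s≢x   | no s≢y   | _        | _        = s , kept ls s≢x s≢y , inj₁ s∈a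
    ... | _        | _        | no t≢x   | no t≢y   = t , kept lt t≢x t≢y , inj₂ t∈b
    ... | yes refl | _        | _        | yes refl = separated ma mb a≢b s∈a t∈b
    ... | _        | yes refl | yes refl | _        with separated mb ma (≢-sym a≢b) t∈b s∈a
    ...   | z , z∈ , inj₁ z∈b = z , z∈ , inj₂ z∈b
    ...   | z , z∈ , inj₂ z∈a = z , z∈ , inj₁ z∈a
    hits m a b ma mb a≢b | s , ls , s∈a | t , lt , t∈b | yes refl | _ | yes refl | _ =
      contradiction (parent-unique ma mb s∈a t∈b) a≢b
    hits m a b ma mb a≢b | s , ls , s∈a | t , lt , t∈b | _ | yes refl | _ | yes refl =
      contradiction (parent-unique ma mb s∈a t∈b) a≢b

  -- Each leaf is sent to an edge covering it. Two leaves on one edge would make every vertex a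
  -- leaf, contrary to `w`. The target `T` may omit edges of `S` that touch no leaf.
  leaves-injection : ∀ {w} → ¬ Leaf G w → ∀ S → IsEdgeCover G S → ∀ T →
    (∀ {e v} → e ∈ S → Leaf G v → Touches G v e → e ∈ T) → ∣ leaves G ∣ ≤ ∣ T ∣
  leaves-injection {w} ¬lw S cover T in-T = injection⇒∣p∣≤∣q∣ (leaves G) T (λ v _ → proj₁ (cover v))
    (λ v v∈ → in-T (proj₁ (proj₂ (cover v))) (∈-comprehension⁻ (leaf? G) v∈) (proj₂ (proj₂ (cover v))))
    λ u v u∈ v∈ eq → decidable-stable (u ≟ v) λ u≢v → ¬lw (adjacent-leaves G conn
      (∈-comprehension⁻ (leaf? G) u∈) (∈-comprehension⁻ (leaf? G) v∈)
      (incident⇒adj G _ (proj₂ (proj₂ (cover u))) (subst (Touches G v) (sym eq) (proj₂ (proj₂ (cover v)))) u≢v) w)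

  -- Trees attaining the bound

  module _ (S : Subset (length (edges G))) (cover : IsEdgeCover G S) (tight : ∣ S ∣ ≤ suc (nonlocalDim G conn)) where

    ¬resolving-below : ∀ X → suc (suc ∣ X ∣) ≤ ∣ S ∣ → ¬ NonlocalResolving G conn X
    ¬resolving-below X small r = <⇒≱ (s≤s⁻¹ (≤-trans small tight)) (nonlocalDim≤ X r)

    -- Without a leaf next to `w`, the cover edge `e` at `w` touches no leaf, so the leaves inject
    -- into `S - e`. Dropping one leaf then leaves a resolving set with at most `∣ S ∣ - 2` members.
    leaf-or-support : ∀ w → ¬ Leaf G w → ∃ λ x → Adj G w x × Leaf G x
    leaf-or-support w ¬lw with any? (λ x → adj? G w x ×-dec leaf? G x)
    ... | yes s = s
    ... | no ¬s = contradiction (all-but-one-leaf-resolves a ¬lw) (¬resolving-below _ (≤-trans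
        (s≤s (≤-trans (x∈p⇒∣p-x∣<∣p∣ (∈-comprehension⁺ (leaf? G) la))
          (leaves-injection ¬lw S cover (S - e) in-S-e)))
        (x∈p⇒∣p-x∣<∣p∣ (proj₁ (proj₂ (cover w))))))
      where
      e : Edge G
      e = proj₁ (cover w)
      aLeaf : ∃ (Leaf G)
      aLeaf = let _ , _ , wp , _ = ¬leaf⇒neighbours G ¬lw
                  z , lz , _     = leaf-beyond wp in z , lz
      a : Fin n
      a = proj₁ aLeaf
      la : Leaf G a
      la = proj₂ aLeaf
      in-S-e : ∀ {f v} → f ∈ S → Leaf G v → Touches G v f → f ∈ S - e
      in-S-e {f} {v} f∈S lv v⊣f = x∈p∧x≢y⇒x∈p-y f∈S λ f≡e →
        ¬s (v , incident⇒adj G e (proj₂ (proj₂ (cover w))) (subst (Touches G v) f≡e v⊣f)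
                  (λ w≡v → ¬lw (subst (Leaf G) (sym w≡v) lv)) , lv)

    threeNeighbours⇒¬leaf : ∀ {c} → ThreeNeighbours G c → ¬ Leaf G c
    threeNeighbours⇒¬leaf (p , q , _ , cp , cq , _ , p≢q , _) lc = p≢q (lc p q cp cq)

    -- Two branching vertices have leaf neighbours, distinct because a leaf has only one neighbour.
    -- There are at most `∣ S ∣` leaves, so dropping these two gives a resolving set that is too
    -- small.
    branching-unique : ∀ {c e} → ThreeNeighbours G c → ThreeNeighbours G e → c ≡ e
    branching-unique {c} {e} three₁ three₂ = decidable-stable (c ≟ e) contra
      where
      contra : ¬ c ≢ e
      contra c≢e with leaf-or-support c (threeNeighbours⇒¬leaf three₁) | leaf-or-support e (threeNeighbours⇒¬leaf three₂)
      ... | x , cx , lx | y , ey , ly = ¬resolving-below _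
        (≤-trans (s≤s (x∈p⇒∣p-x∣<∣p∣ y∈)) (≤-trans (x∈p⇒∣p-x∣<∣p∣ (∈-comprehension⁺ (leaf? G) lx))
          (leaves-injection (threeNeighbours⇒¬leaf three₁) S cover S (λ f∈ _ _ → f∈))))
        (all-but-two-leaves-resolve lx (symm G cx) three₁ ly (symm G ey) three₂ c≢e)
        where
        y∈ : y ∈ leaves G - x
        y∈ = x∈p∧x≢y⇒x∈p-y (∈-comprehension⁺ (leaf? G) ly)
          λ y≡x → c≢e (lx _ _ (symm G cx) (symm G (subst (Adj G e) y≡x ey)))

-- Recognising a partly subdivided star

lookup-injective-unique : ∀ {A : Set} {xs : List A} → Uniqueˡ xs → ∀ i j → lookup xs i ≡ lookup xs j → i ≡ j
lookup-injective-unique {xs = x ∷ xs} (x∉ ∷ uq) zero    zero    eq = refl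
lookup-injective-unique {xs = x ∷ xs} (x∉ ∷ uq) zero    (suc j) eq = contradiction eq (All.lookup x∉ (∈-lookup j))
lookup-injective-unique {xs = x ∷ xs} (x∉ ∷ uq) (suc i) zero    eq = contradiction (sym eq) (All.lookup x∉ (∈-lookup i))
lookup-injective-unique {xs = x ∷ xs} (x∉ ∷ uq) (suc i) (suc j) eq = cong suc (lookup-injective-unique uq i j eq)

module StarShape {n : ℕ} (G : Graph (Fin n)) (conn : Connected G) (c : Fin n)
  (pendant : ∃ λ x → Adj G c x × Leaf G x)
  (legs : ∀ w → Adj G c w → ¬ Leaf G w →
    ∃ λ t → Adj G w t × t ≢ c × Leaf G t × (∀ s → Adj G w s → s ≢ c → s ≡ t)) where

  nbrs : List (Fin n)
  nbrs = filter (adj? G c) (allFin n)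

  m : ℕ
  m = length nbrs

  nbr : Fin m → Fin n
  nbr = lookup nbrs

  adj-nbr : ∀ i → Adj G c (nbr i)
  adj-nbr i = proj₂ (∈-filter⁻ (adj? G c) {xs = allFin n} (∈-lookup {xs = nbrs} i))

  nbr≢c : ∀ {i} → nbr i ≢ c
  nbr≢c {i} eq = irrefl G (sym eq) (adj-nbr i)

  nbr-surjective : ∀ {v} → Adj G c v → ∃ λ i → nbr i ≡ v
  nbr-surjective {v} a = let p = ∈-filter⁺ (adj? G c) (∈-allFin v) a in index p , sym (lookup-index p)

  nbr-injective : ∀ {i j} → nbr i ≡ nbr j → i ≡ j
  nbr-injective = lookup-injective-unique (filter⁺ (adj? G c) (allFin⁺ n)) _ _

  long? : Decidable (λ i → ¬ Leaf G (nbr i))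
  long? i = ¬? (leaf? G (nbr i))

  L : Subset m
  L = comprehension long?

  -- The tip `t` is an index, so matching decides whether it is the neighbour of `c` itself or a
  -- leaf behind it.
  data Leg (i : Fin m) (t : Fin n) : Set where
    short : Leaf G (nbr i) → t ≡ nbr i → Leg i t
    long  : ¬ Leaf G (nbr i) → Adj G (nbr i) t → t ≢ c → Leaf G t →
      (∀ s → Adj G (nbr i) s → s ≢ c → s ≡ t) → Leg i t

  leg : ∀ i → ∃ (Leg i)
  leg i with leaf? G (nbr i)
  ... | yes l = nbr i , short l refl
  ... | no ¬l = let t , a , t≢c , lt , uniq = legs (nbr i) (adj-nbr i) ¬l in t , long ¬l a t≢c lt uniq

  tip : Fin m → Fin n
  tip i = proj₁ (leg i)

  g : StarVertex L → Fin n
  g centre    = c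
  g (leaf i)  = tip i
  g (mid i _) = nbr i

  tip≢c : ∀ {i t} → Leg i t → t ≢ c
  tip≢c (short _ refl)     = nbr≢c
  tip≢c (long _ _ t≢c _ _) = t≢c

  leaf-not-adj-c : ∀ {i t} → Adj G (nbr i) t → Leaf G t → ¬ Adj G c t
  leaf-not-adj-c {i} a lt ct = nbr≢c {i} (lt _ _ (symm G a) (symm G ct))

  tip-injective : ∀ {i j t} → Leg i t → Leg j t → i ≡ j
  tip-injective (short _ refl)     (short _ eq)       = nbr-injective eq
  tip-injective (short _ refl)     (long _ a _ lt _)  = contradiction (adj-nbr _) (leaf-not-adj-c a lt)
  tip-injective (long _ a _ lt _)  (short _ refl)     = contradiction (adj-nbr _) (leaf-not-adj-c a lt)
  tip-injective (long _ a _ lt _)  (long _ b _ _ _)   = nbr-injective (lt _ _ (symm G a) (symm G b))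

  tip≢nbr : ∀ {i j t} → Leg i t → j ∈ L → t ≢ nbr j
  tip≢nbr (short l refl)    j∈L eq with nbr-injective eq
  ... | refl = ∈-comprehension⁻ long? j∈L l
  tip≢nbr (long _ a _ lt _) j∈L refl = leaf-not-adj-c a lt (adj-nbr _)

  g-injective : ∀ {s t} → g s ≡ g t → s ≡ t
  g-injective {centre}  {centre}  eq = refl
  g-injective {centre}  {leaf i}  eq = contradiction (sym eq) (tip≢c (proj₂ (leg i)))
  g-injective {centre}  {mid i _} eq = contradiction (sym eq) nbr≢c
  g-injective {leaf i}  {centre}  eq = contradiction eq (tip≢c (proj₂ (leg i)))
  g-injective {leaf i}  {leaf j}  eq =
    cong leaf (tip-injective (proj₂ (leg i)) (subst (Leg j) (sym eq) (proj₂ (leg j))))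
  g-injective {leaf i}  {mid j q} eq = contradiction eq (tip≢nbr (proj₂ (leg i)) q)
  g-injective {mid i p} {centre}  eq = contradiction eq nbr≢c
  g-injective {mid i p} {leaf j}  eq = contradiction (sym eq) (tip≢nbr (proj₂ (leg j)) p)
  g-injective {mid i p} {mid j q} eq with nbr-injective eq
  ... | refl = cong (mid i) ([]=-irrelevant p q)

  -- The image contains `c` and is closed under adjacency.
  g-surjective : ∀ v → ∃ λ s → g s ≡ v
  g-surjective v = walk-closed {G = G} {P = λ v → ∃ λ s → g s ≡ v} closed
    (path⇒walk (proj₂ (conn c v))) (centre , refl)
    where
    nbr-in-image : ∀ {v} → Adj G c v → ∃ λ s → g s ≡ v
    nbr-in-image a with nbr-surjective a
    ... | i , refl with leg i in eq
    ...   | t , short _ refl     = leaf i , cong proj₁ eq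
    ...   | t , long ¬l _ _ _ _  = mid i (∈-comprehension⁺ long? ¬l) , refl
    closed : ∀ {u v} → Adj G u v → (∃ λ s → g s ≡ u) → ∃ λ s → g s ≡ v
    closed uv (centre , refl) = nbr-in-image uv
    closed uv (mid i p , refl) with proj₂ (leg i)
    ... | short l _ = contradiction l (∈-comprehension⁻ long? p)
    closed {v = v} uv (mid i p , refl) | long _ _ _ _ uniq with v ≟ c
    ... | yes refl = centre , refl
    ... | no v≢c   = leaf i , sym (uniq v uv v≢c)
    closed uv (leaf i , refl) with leg i
    ... | _ , short l refl      = centre , l _ _ (symm G (adj-nbr i)) uv
    ... | _ , long ¬l a _ lt _  = mid i (∈-comprehension⁺ long? ¬l) , lt _ _ (symm G a) uv

  edge⇒adj : ∀ {s t} → StarEdge L s t → Adj G (g s) (g t)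
  edge⇒adj (whole {i} i∉L) with leg i
  ... | _ , short _ refl     = adj-nbr i
  ... | _ , long ¬l _ _ _ _  = contradiction (∈-comprehension⁺ long? ¬l) i∉L
  edge⇒adj (inner {i}) = adj-nbr i
  edge⇒adj (outer {i} {p}) with leg i
  ... | _ , short l _       = contradiction l (∈-comprehension⁻ long? p)
  ... | _ , long _ a _ _ _  = a

  tips-not-adj : ∀ {i j t t′} → Leg i t → Leg j t′ → ¬ Adj G t t′
  tips-not-adj (short l refl)     leg′ a = tip≢c leg′ (l _ _ a (symm G (adj-nbr _)))
  tips-not-adj (long ¬l b _ lt _) leg′ a =
    tip≢nbr leg′ (∈-comprehension⁺ long? ¬l) (lt _ _ a (symm G b))

  tip-nbr-adj : ∀ {i j t} → Leg i t → Adj G t (nbr j) → i ≡ j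
  tip-nbr-adj (short l refl)    a = contradiction (l _ _ a (symm G (adj-nbr _))) nbr≢c
  tip-nbr-adj (long _ b _ lt _) a = nbr-injective (lt _ _ (symm G b) a)

  c-tip-adj : ∀ {i t} → Leg i t → Adj G c t → i ∉ L
  c-tip-adj (short l _)       _  i∈L = ∈-comprehension⁻ long? i∈L l
  c-tip-adj (long _ a _ lt _) ct _   = leaf-not-adj-c a lt ct

  adj⇒starAdj : ∀ s t → Adj G (g s) (g t) → Adj (subdividedStar L) s t
  adj⇒starAdj centre    centre    a = contradiction a (irrefl G refl)
  adj⇒starAdj centre    (leaf i)  a = fwd (whole (c-tip-adj (proj₂ (leg i)) a))
  adj⇒starAdj centre    (mid i p) a = fwd inner
  adj⇒starAdj (leaf i)  centre    a = bwd (whole (c-tip-adj (proj₂ (leg i)) (symm G a)))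
  adj⇒starAdj (leaf i)  (leaf j)  a = contradiction a (tips-not-adj (proj₂ (leg i)) (proj₂ (leg j)))
  adj⇒starAdj (leaf i)  (mid j q) a with tip-nbr-adj (proj₂ (leg i)) a
  ... | refl = bwd outer
  adj⇒starAdj (mid i p) centre    a = bwd inner
  adj⇒starAdj (mid i p) (leaf j)  a with tip-nbr-adj (proj₂ (leg j)) (symm G a)
  ... | refl = fwd outer
  adj⇒starAdj (mid i p) (mid j q) a with proj₂ (leg i)
  ... | short l _           = contradiction l (∈-comprehension⁻ long? p)
  ... | long _ b _ lt uniq  = contradiction
    (subst (Adj G c) (uniq _ a nbr≢c) (adj-nbr j)) (leaf-not-adj-c b lt)

  g-bijection : StarVertex L ⤖ Fin n
  g-bijection = mk⤖ (g-injective , λ v → let s , eq = g-surjective v in s , λ where refl → eq)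

  isPartlySubdividedStar : IsPartlySubdividedStar G
  isPartlySubdividedStar =
    let x , cx , lx = pendant
        i , eq      = nbr-surjective cx
        f           = ↔-sym (⤖⇒↔ g-bijection)
        g∘f v       = proj₂ (g-surjective v)
    in m , nonempty i , L ,
       (i , λ i∈L → ∈-comprehension⁻ long? i∈L (subst (Leaf G) (sym eq) lx)) ,
       record
         { bijection = f
         ; adjacency = λ u v → mk⇔
             (λ a → adj⇒starAdj _ _ (subst₂ (Adj G) (sym (g∘f u)) (sym (g∘f v)) a))
             (λ e → subst₂ (Adj G) (g∘f u) (g∘f v) (star-adj e))
         }
    where
    nonempty : ∀ {k} → Fin k → 1 ≤ k
    nonempty zero    = s≤s z≤n
    nonempty (suc _) = s≤s z≤n
    star-adj : ∀ {s t} → Adj (subdividedStar L) s t → Adj G (g s) (g t)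
    star-adj (fwd e) = edge⇒adj e
    star-adj (bwd e) = symm G (edge⇒adj e)

-- The centre is the branching vertex if there is one, otherwise any non-leaf; if all vertices are
-- leaves, the graph is a single edge and any vertex serves.
tight⇒star : ∀ {n} (G : Graph (Fin n)) (conn : Connected G) (2≤n : 2 ≤ n) → Acyclic G →
  nonlocalDim G conn + 1 ≡ edgeCoverNumber G conn 2≤n → IsPartlySubdividedStar G
tight⇒star {n} G conn 2≤n acyclic tight = choose
  where
  S : ∃ λ T → IsEdgeCover G T × ∣ T ∣ ≡ edgeCoverNumber G conn 2≤n
  S = minimumEdgeCover G conn 2≤n
  ∣S∣≤ : ∣ proj₁ S ∣ ≤ suc (nonlocalDim G conn)
  ∣S∣≤ = ≤-reflexive (trans (proj₂ (proj₂ S)) (trans (sym tight) (+-comm _ 1)))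
  support : ∀ w → ¬ Leaf G w → ∃ λ x → Adj G w x × Leaf G x
  support = TreeLeaves.leaf-or-support G conn acyclic (proj₁ S) (proj₁ (proj₂ S)) ∣S∣≤
  branching : ∀ {c e} → ThreeNeighbours G c → ThreeNeighbours G e → c ≡ e
  branching = TreeLeaves.branching-unique G conn acyclic (proj₁ S) (proj₁ (proj₂ S)) ∣S∣≤
  star-around : ∀ c → ¬ Leaf G c → (∀ w → Adj G c w → ¬ ThreeNeighbours G w) → IsPartlySubdividedStar G
  star-around c ¬lc ¬three = StarShape.isPartlySubdividedStar G conn c (support c ¬lc) legs
    where
    legs : ∀ w → Adj G c w → ¬ Leaf G w →
      ∃ λ t → Adj G w t × t ≢ c × Leaf G t × (∀ s → Adj G w s → s ≢ c → s ≡ t)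
    legs w cw ¬lw with support w ¬lw
    -- A neighbour `s` of `w` besides `c` and `t` would make `w` a branching vertex.
    ... | t , wt , lt = t , wt , t≢c , lt , λ s ws s≢c → decidable-stable (s ≟ t)
        (λ s≢t → ¬three w cw (s , t , c , ws , wt , symm G cw , s≢t , s≢c , t≢c))
      where
      t≢c : t ≢ c
      t≢c t≡c = ¬lc (subst (Leaf G) t≡c lt)
  choose : IsPartlySubdividedStar G
  choose with any? (threeNeighbours? G)
  ... | yes (c , three@(p , q , _ , cp , cq , _ , p≢q , _)) = star-around c (λ lc → p≢q (lc p q cp cq))
    λ w cw three′ → irrefl G (branching three three′) cw
  ... | no ¬three with any? (λ c → ¬? (leaf? G c))
  ...   | yes (c , ¬lc)  = star-around c ¬lc λ w _ three → ¬three (w , three)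
  ...   | no all-leaves  = StarShape.isPartlySubdividedStar G conn c
      (let x , cx = neighbour G conn 2≤n c in x , cx , is-leaf x) λ w _ ¬lw → contradiction (is-leaf w) ¬lw
    where
    c : Fin n
    c = fromℕ< (≤-trans (s≤s z≤n) 2≤n)
    is-leaf : ∀ v → Leaf G v
    is-leaf v = decidable-stable (leaf? G v) λ ¬lv → all-leaves (v , ¬lv)

-- The dimension of a partly subdivided star

module _ {m : ℕ} (S : Subset m) where

  branch : StarVertex S → Maybe (Fin m)
  branch centre    = nothing
  branch (leaf i)  = just i
  branch (mid i _) = just i

  adj-branch : ∀ {s t i} → Adj (subdividedStar S) s t → branch s ≡ just i → branch t ≡ just i ⊎ t ≡ centre
  adj-branch (fwd (whole _)) ()
  adj-branch (fwd inner)     ()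
  adj-branch (fwd outer)     eq = inj₁ eq
  adj-branch (bwd (whole _)) eq = inj₂ refl
  adj-branch (bwd inner)     eq = inj₂ refl
  adj-branch (bwd outer)     eq = inj₁ eq

  innermost : ∀ i → ∃ λ s → branch s ≡ just i × Adj (subdividedStar S) s centre
  innermost i with i ∈? S
  ... | yes p = mid i p , refl , bwd inner
  ... | no ¬p = leaf i , refl , bwd (whole ¬p)

  -- The equations identify the second vertex covered by the edge at `leaf i`: the subdividing
  -- vertex, or the centre if the leg is whole.
  attachment : ∀ i → ∃ λ s → Adj (subdividedStar S) (leaf i) s ×
    ((p : i ∈ S) → mid i p ≡ s) × (i ∉ S → centre ≡ s)
  attachment i with i ∈? S
  ... | yes p = mid i p , bwd outer , (λ q → cong (mid i) ([]=-irrelevant q p)) , contradiction p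
  ... | no ¬p = centre , bwd (whole ¬p) , (λ p → contradiction p ¬p) , λ _ → refl

module StarDimension {n m : ℕ} (G : Graph (Fin n)) (conn : Connected G) (S : Subset m)
  (iso : G ≅ subdividedStar S) where

  open _≅_ iso
  open Distance G conn

  to : Fin n → StarVertex S
  to = Inverse.to bijection

  from : StarVertex S → Fin n
  from = Inverse.from bijection

  to∘from : ∀ s → to (from s) ≡ s
  to∘from = Inverse.strictlyInverseˡ bijection

  from∘to : ∀ v → from (to v) ≡ v
  from∘to = Inverse.strictlyInverseʳ bijection

  to-adj : ∀ {u v} → Adj G u v → Adj (subdividedStar S) (to u) (to v)
  to-adj {u} {v} = Equivalence.to (adjacency u v)

  from-adj : ∀ {s t} → Adj (subdividedStar S) s t → Adj G (from s) (from t)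
  from-adj {s} {t} a = Equivalence.from (adjacency (from s) (from t))
    (subst₂ (Adj (subdividedStar S)) (sym (to∘from s)) (sym (to∘from t)) a)

  inn : Fin m → Fin n
  inn i = from (proj₁ (innermost S i))

  branch-inn : ∀ i → branch S (to (inn i)) ≡ just i
  branch-inn i = trans (cong (branch S) (to∘from _)) (proj₁ (proj₂ (innermost S i)))

  -- A walk leaving branch i enters the centre, which is adjacent to inn j.
  reroute : ∀ {u x k i} j → branch S (to u) ≡ just i → branch S (to x) ≢ just i → Walk G u x k → d (inn j) x ≤ k
  reroute j u∈i x∉i stop = contradiction u∈i x∉i
  reroute j u∈i x∉i (step {v = v} a p) with adj-branch S (to-adj a) u∈i
  ... | inj₁ v∈i = m≤n⇒m≤1+n (reroute j v∈i x∉i p)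
  ... | inj₂ v≡c = d≤walk (step inn-v p)
    where
    inn-v : Adj G (inn j) v
    inn-v = subst (Adj G (inn j)) (trans (cong from (sym v≡c)) (from∘to v)) (from-adj (proj₂ (proj₂ (innermost S j))))

  -- A geodesic from either vertex passes through the centre, from where the other vertex can take
  -- it over.
  inn-equidistant : ∀ {i j x} → branch S (to x) ≢ just i → branch S (to x) ≢ just j → d (inn i) x ≡ d (inn j) x
  inn-equidistant {i} {j} {x} x∉i x∉j = ≤-antisym
    (reroute i (branch-inn j) x∉j (geodesic (inn j) x)) (reroute j (branch-inn i) x∉i (geodesic (inn i) x))

  inn-injective : ∀ {i j} → inn i ≡ inn j → i ≡ j
  inn-injective {i} {j} eq = just-injective
    (trans (sym (branch-inn i)) (trans (cong (λ v → branch S (to v)) eq) (branch-inn j)))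

  inn-not-adj : ∀ {i j} → i ≢ j → ¬ Adj G (inn i) (inn j)
  inn-not-adj {i} {j} i≢j a with adj-branch S (to-adj a) (branch-inn i)
  ... | inj₁ eq = i≢j (just-injective (trans (sym eq) (branch-inn j)))
  ... | inj₂ eq with trans (sym (cong (branch S) eq)) (branch-inn j)
  ...   | ()

  -- If `X` missed two legs, their innermost vertices would be non-adjacent and equidistant from all
  -- of `X`. So at most one leg is missed, and the others contain distinct members of `X`.
  m≤1+resolving : ∀ X → NonlocalResolving G conn X → m ≤ suc ∣ X ∣
  m≤1+resolving X res = subst (_≤ suc ∣ X ∣) (∣⊤∣≡n m)
    -- The slot put in front of `X` receives the missed leg.
    (injection⇒∣p∣≤∣q∣ ⊤ (inside ∷ X) (λ i _ → slot (hit? i)) (λ i _ → slot∈ (hit? i)) λ i j _ _ → slot-injective (hit? i) (hit? j))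
    where
    Hit : Fin m → Set
    Hit i = ∃ λ x → x ∈ X × branch S (to x) ≡ just i
    hit? : Decidable Hit
    hit? i = any? λ x → (x ∈? X) ×-dec ≡-dec _≟_ (branch S (to x)) (just i)
    slot : ∀ {i} → Dec (Hit i) → Fin (suc n)
    slot (yes (x , _)) = suc x
    slot (no _)        = zero
    slot∈ : ∀ {i} (h : Dec (Hit i)) → slot h ∈ inside ∷ X
    slot∈ (yes (x , x∈X , _)) = there x∈X
    slot∈ (no _)              = here
    slot-injective : ∀ {i j} (h : Dec (Hit i)) (h′ : Dec (Hit j)) → slot h ≡ slot h′ → i ≡ j
    slot-injective (yes (x , _ , p)) (yes (y , _ , q)) eq with suc-injective eq
    ... | refl = just-injective (trans (sym p) q)
    slot-injective {i} {j} (no ¬h) (no ¬h′) _ = decidable-stable (i ≟ j) λ i≢j →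
      let x , x∈X , ne = res (inn i) (inn j) (λ eq → i≢j (inn-injective eq)) (inn-not-adj i≢j)
      in ne (inn-equidistant (λ x∈i → ¬h (x , x∈X , x∈i)) (λ x∈j → ¬h′ (x , x∈X , x∈j)))

  leafEdge : ∀ i → ∃ λ e → Touches G (from (leaf i)) e × Touches G (from (proj₁ (attachment S i))) e
  leafEdge i = adj⇒edge G (from-adj (proj₁ (proj₂ (attachment S i))))

  leafEdge? : Decidable (λ e → ∃ λ i → proj₁ (leafEdge i) ≡ e)
  leafEdge? e = any? λ i → proj₁ (leafEdge i) ≟ e

  leafEdges : Subset (length (edges G))
  leafEdges = comprehension leafEdge?

  ∣leafEdges∣≤m : ∣ leafEdges ∣ ≤ m
  ∣leafEdges∣≤m = ≤-trans
    (injection⇒∣p∣≤∣q∣ leafEdges ⊤ (λ e e∈ → proj₁ (∈-comprehension⁻ leafEdge? e∈)) (λ _ _ → ∈⊤)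
      λ e f e∈ f∈ eq → trans (sym (proj₂ (∈-comprehension⁻ leafEdge? e∈)))
        (trans (cong (λ i → proj₁ (leafEdge i)) eq) (proj₂ (∈-comprehension⁻ leafEdge? f∈))))
    (≤-reflexive (∣⊤∣≡n m))

  -- The edge at the leaf of a subdivided leg also covers the subdividing vertex, and that of the
  -- kept leg `k` covers the centre.
  leafEdges-cover : (∃ λ i → i ∉ S) → IsEdgeCover G leafEdges
  leafEdges-cover (k , k∉S) v = covered (to v) (from∘to v)
    where
    at : ∀ i → Touches G v (proj₁ (leafEdge i)) → ∃ λ e → e ∈ leafEdges × Touches G v e
    at i v⊣e = proj₁ (leafEdge i) , ∈-comprehension⁺ leafEdge? (i , refl) , v⊣e
    attached : ∀ i {s} → s ≡ proj₁ (attachment S i) → from s ≡ v → Touches G v (proj₁ (leafEdge i))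
    attached i refl refl = proj₂ (proj₂ (leafEdge i))
    covered : ∀ s → from s ≡ v → ∃ λ e → e ∈ leafEdges × Touches G v e
    covered centre    eq   = at k (attached k (proj₂ (proj₂ (proj₂ (attachment S k))) k∉S) eq)
    covered (leaf i)  refl = at i (proj₁ (proj₂ (leafEdge i)))
    covered (mid i p) eq   = at i (attached i (proj₁ (proj₂ (proj₂ (attachment S i))) p) eq)

star⇒edgeCoverNumber≤ : ∀ {n} (G : Graph (Fin n)) (conn : Connected G) (2≤n : 2 ≤ n) →
  IsPartlySubdividedStar G → edgeCoverNumber G conn 2≤n ≤ suc (nonlocalDim G conn)
star⇒edgeCoverNumber≤ G conn 2≤n (m , _ , S , kept , iso) =
  let open StarDimension G conn S iso
      X , res , ∣X∣≡ = Distance.nonlocalBasis G conn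
  in ≤-trans (edgeCoverNumber≤ G conn 2≤n leafEdges (leafEdges-cover kept))
       (≤-trans ∣leafEdges∣≤m (subst (λ k → m ≤ suc k) ∣X∣≡ (m≤1+resolving X res)))

theorem5p3 : ∀ {n} (G : Graph (Fin n)) (conn : Connected G) (2≤n : 2 ≤ n) →
    ([ 7 ] ≤⁺ girth G → nonlocalDim G conn + 1 ≤ edgeCoverNumber G conn 2≤n)
    × (IsTree G → (nonlocalDim G conn + 1 ≡ edgeCoverNumber G conn 2≤n) ⇔ IsPartlySubdividedStar G)
theorem5p3 G conn 2≤n =
  (λ 7≤girth → bound (girth-bound G 7≤girth (s≤s (s≤s (s≤s (s≤s z≤n)))))
                     (girth-bound G 7≤girth (s≤s (s≤s (s≤s (s≤s (s≤s z≤n))))))) ,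
  -- Acyclicity excludes triangles and squares, so the bound applies to trees; a star adds the
  -- reverse inequality.
  λ (_ , acyclic) → mk⇔ (tight⇒star G conn 2≤n acyclic) λ star → ≤-antisym
    (bound (λ c → acyclic (3 , c)) (λ c → acyclic (4 , c)))
    (≤-trans (star⇒edgeCoverNumber≤ G conn 2≤n star) (≤-reflexive (+-comm 1 _)))
  where
  bound : ¬ CycleOfLength G 3 → ¬ CycleOfLength G 4 → nonlocalDim G conn + 1 ≤ edgeCoverNumber G conn 2≤n
  bound ¬c₃ ¬c₄ = ≤-trans (≤-reflexive (+-comm _ 1)) (nonlocalDim<edgeCoverNumber G conn 2≤n ¬c₃ ¬c₄)
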